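{- Let $p$ be a prime and $\mathcal{H}=\{H_1,\dots,H_r\}$ a set of pairwise non-isomorphic order-$p$ reduced graphs. Then there exist quantum graphs $\bar{F}_1,\dots,\bar{F}_r$, each with at most $2^c$ constituents where $c$ is polynomial in the number of vertices of the graphs in $\mathcal{H}$, such that for all $i,j\in[r]$, $\hom(\bar{F}_i,H_j)\equiv1\pmod p$ if $i=j$ and $\hom(\bar{F}_i,H_j)\equiv0\pmod p$ if $i\neq j$.
   Context: Graphs are finite, undirected, may have loops, no multiple edges. $\hom(G,H)$ is the number of homomorphisms $G\to H$. A graph is order-$p$ reduced if it has no automorphism of order $p$ (non-identity automorphism $\varrho$ with $\varrho^p=\mathrm{id}$). A quantum graph is a formal finite linear combination $\bar F=\sum_{F}\beta_F F$ of pairwise non-isomorphic graphs (its constituents) with coefficients in $\mathbb{Z}_p$, and $\hom(\bar{F},H)=\sum_F\beta_F\hom(F,H)$. -}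

module Defs where

open import Data.Nat using (ℕ; zero; suc; _+_; _*_)
open import Data.Bool using (Bool; true; false)
open import Data.Fin using (Fin; toℕ)
open import Data.Fin.Properties using (_≟_)
open import Data.List using (List; []; _∷_; map; concatMap; length; filter; foldr)
open import Data.List.Relation.Unary.AllPairs using (AllPairs)
open import Data.Product using (Σ; ∃; _×_; _,_; proj₁; proj₂)
open import Relation.Nullary using (¬_; Dec; yes; no)
open import Relation.Binary.PropositionalEquality using (_≡_; _≢_)
open import Function using (_∘_; id)

-- Graphs: finite vertex set Fin n, symmetric adjacency (loops allowed,
-- no multiple edges).

record Graph : Set where
  field
    n   : ℕ
    adj : Fin n → Fin n → Bool
    sym : ∀ u v → adj u v ≡ adj v u
open Graph public

Edge : (G : Graph) → Fin (n G) → Fin (n G) → Set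
Edge G u v = adj G u v ≡ true

IsHom : (G H : Graph) → (Fin (n G) → Fin (n H)) → Set
IsHom G H f = ∀ u v → Edge G u v → Edge H (f u) (f v)

extend : {a b : ℕ} → Fin b → (Fin a → Fin b) → Fin (suc a) → Fin b
extend x f Fin.zero    = x
extend x f (Fin.suc i) = f i

allFins : (b : ℕ) → List (Fin b)
allFins zero    = []
allFins (suc b) = Fin.zero ∷ map Fin.suc (allFins b)

allFuns : (a b : ℕ) → List (Fin a → Fin b)
allFuns zero    b = (λ ()) ∷ []
allFuns (suc a) b = concatMap (λ x → map (extend x) (allFuns a b)) (allFins b)

private
  allFin? : (k : ℕ) (P : Fin k → Set) → (∀ i → Dec (P i)) → Dec (∀ i → P i)
  allFin? zero P d = yes (λ ())
  allFin? (suc k) P d with d Fin.zero | allFin? k (P ∘ Fin.suc) (d ∘ Fin.suc)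
  ... | no ¬p | _ = no (λ h → ¬p (h Fin.zero))
  ... | yes p | no ¬q = no (λ h → ¬q (λ i → h (Fin.suc i)))
  ... | yes p | yes q = yes (λ { Fin.zero → p ; (Fin.suc i) → q i })

  impl? : (b c : Bool) → Dec (b ≡ true → c ≡ true)
  impl? false c = yes (λ ())
  impl? true true = yes (λ _ → Relation.Binary.PropositionalEquality.refl)
  impl? true false = no (λ h → lem (h Relation.Binary.PropositionalEquality.refl))
    where
    lem : false ≢ true
    lem ()

isHom? : (G H : Graph) (f : Fin (n G) → Fin (n H)) → Dec (IsHom G H f)
isHom? G H f = allFin? (n G) _ λ u → allFin? (n G) _ λ v →
  impl? (adj G u v) (adj H (f u) (f v))

hom : Graph → Graph → ℕ
hom G H = length (filter (isHom? G H) (allFuns (n G) (n H)))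

record Iso (G H : Graph) : Set where
  field
    to      : Fin (n G) → Fin (n H)
    from    : Fin (n H) → Fin (n G)
    from-to : ∀ u → from (to u) ≡ u
    to-from : ∀ v → to (from v) ≡ v
    pres    : ∀ u v → adj G u v ≡ adj H (to u) (to v)

Automorphism : Graph → Set
Automorphism G = Iso G G

iter : {A : Set} → (A → A) → ℕ → A → A
iter f zero    = id
iter f (suc k) = f ∘ iter f k

HasAutOfOrder : ℕ → Graph → Set
HasAutOfOrder p G = Σ (Automorphism G) λ ϱ →
  (∃ λ v → Iso.to ϱ v ≢ v) × (∀ v → iter (Iso.to ϱ) p v ≡ v)

OrderReduced : ℕ → Graph → Set
OrderReduced p G = ¬ HasAutOfOrder p G

-- Quantum graphs over ℤ_p: a finite list of (coefficient, graph) pairs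
-- with pairwise non-isomorphic graphs (the constituents).

QTerms : ℕ → Set
QTerms p = List (Fin p × Graph)

record QuantumGraph (p : ℕ) : Set where
  field
    terms    : QTerms p
    distinct : AllPairs (λ a b → ¬ Iso (proj₂ a) (proj₂ b)) terms
open QuantumGraph public

size : {p : ℕ} → QuantumGraph p → ℕ
size F = length (terms F)

-- hom(F̄, H) = Σ β_F hom(F, H)  (computed in ℕ with representatives 0..p-1)
qhom : {p : ℕ} → QuantumGraph p → Graph → ℕ
qhom F H = foldr (λ t acc → toℕ (proj₁ t) * hom (proj₂ t) H + acc) 0 (terms F)

_≡_[mod_] : ℕ → ℕ → ℕ → Set
x ≡ y [mod p ] = ∃ λ a → ∃ λ b → x + a * p ≡ y + b * p

totalVertices : (r : ℕ) → (Fin r → Graph) → ℕ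
totalVertices zero    H = 0
totalVertices (suc r) H = n (H Fin.zero) + totalVertices r (H ∘ Fin.suc)

{-# OPTIONS --safe #-}

-- Counting embeddings F ↪ H is, by deletion–contraction on pairs of vertices of F, a linear combination of
-- the functions hom(F′, –) over quotients F′ of F. If F ↪ H then F has at most as many vertices plus edges as H,
-- with equality only if F ≅ H. So the matrix of embedding counts between the H i is triangular, and its
-- diagonal entries |Aut (H i)| are units modulo p by Cauchy's theorem; inverting it modulo p gives the dual
-- family. All graphs involved have at most N = Σ |V (H i)| vertices, so every combination can be rewritten over
-- one representative per isomorphism class, and counting adjacency matrices bounds their number by 2 ^ (1 + N)².

module Submission where

open import Defs
open import Algebra.Structures using (IsMonoid)
open import Data.Bool using (Bool; true; false; _∨_)
import Data.Bool.Properties as Bool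
open import Data.Empty using (⊥-elim)
open import Data.Fin as Fin using (Fin; toℕ; fromℕ<; punchIn; punchOut)
open import Data.Fin.Properties as Fin using (_≟_; any?; all?; injective⇒≤; toℕ-fromℕ<; punchIn-punchOut; punchOut-punchIn; punchOut-cong; punchInᵢ≢i)
open import Data.List as List using (List; []; _∷_; _++_; [_]; map; length; filter; concatMap; applyUpTo; cartesianProduct; cartesianProductWith; deduplicate)
open import Data.List.Membership.Propositional using (_∈_; _∉_; find; lose)
open import Data.List.Membership.Propositional.Properties using (∈-map⁺; ∈-map⁻; ∈-filter⁺; ∈-filter⁻; ∈-++⁺ˡ; ∈-++⁺ʳ; ∈-++⁻; ∈-∃++; ∈-applyUpTo⁺; ∈-applyUpTo⁻; ∈-cartesianProductWith⁺; ∈-cartesianProductWith⁻; ∈-cartesianProduct⁺)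
import Data.List.Membership.DecPropositional as DecMembership
open import Data.List.Properties as List using (length-++; length-++-sucʳ; length-map; length-filter; length-applyUpTo; ++-identityʳ; ++-assoc; map-∘; map-++)
open import Data.List.Relation.Binary.Subset.Propositional using (_⊆_)
open import Data.List.Relation.Unary.All as All using (All; []; _∷_)
open import Data.List.Relation.Unary.All.Properties as All using (¬Any⇒All¬)
open import Data.List.Relation.Unary.AllPairs using (AllPairs; []; _∷_)
import Data.List.Relation.Unary.AllPairs.Properties as AllPairs
open import Data.List.Relation.Unary.Any as Any using (Any; here; there)
import Data.List.Relation.Unary.Any.Properties as Any
open import Data.List.Relation.Unary.Unique.DecSetoid.Properties using (deduplicate-!)
open import Data.List.Relation.Unary.Unique.Propositional using (Unique)
import Data.List.Relation.Unary.Unique.Propositional.Properties as Unique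
open import Data.Nat using (ℕ; zero; suc; pred; _+_; _*_; _^_; _∸_; _/_; _%_; _≤_; _<_; z≤n; s≤s; NonZero; >-nonZero)
open import Data.Nat.Coprimality using (Coprime; prime⇒coprime; coprime-Bézout)
open import Data.Nat.Divisibility using (_∣_; _∣0; ∣-refl; ∣-trans; ∣m∣n⇒∣m+n; ∣m+n∣m⇒∣n; ∣1⇒≡1; m∣m*n)
open import Data.Nat.DivMod using (%-distribˡ-+; %-distribˡ-*; m%n%n≡m%n; m%n<n; m≡m%n+[m/n]*n; [m+kn]%n≡m%n)
open import Data.Nat.GCD using (module Bézout)
open import Data.Nat.Induction using (<-wellFounded)
open import Data.Nat.Primality using (Prime; ¬prime[0]; ¬prime[1]; prime⇒nonZero; prime⇒irreducible)
open import Data.Nat.Properties hiding (_≟_)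
open import Algebra.Properties.Semiring.Sum +-*-semiring using (sum; sum-cong-≗; ∑-distrib-+; *-distribˡ-sum)
open import Data.Product as Product using (∃; _×_; _,_; proj₁; proj₂; uncurry)
import Data.Product.Properties as Product
open import Data.Sum using (inj₁; inj₂)
open import Data.Vec as Vec using (Vec; []; _∷_; _∷ʳ_; toList; replicate; tabulate; lookup)
import Data.Vec.Properties as Vec
open import Data.Vec.Relation.Unary.All as VAll using ([]; _∷_)
open import Function using (_∘_; id; mk⇔)
open import Induction.WellFounded using (Acc; acc)
open import Level using (0ℓ)
open import Relation.Binary.Bundles using (DecSetoid)
open import Relation.Binary.Definitions using (DecidableEquality)
open import Relation.Binary.PropositionalEquality using (_≡_; _≢_; refl; trans; cong; cong₂; subst; isEquivalence; module ≡-Reasoning) renaming (sym to ≡-sym)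
open import Relation.Nullary using (¬_; Dec; yes; no; does; contradiction)
open import Relation.Nullary.Decidable using (¬?; decidable-stable; _×-dec_; _→-dec_; does-⇔; dec-true; map′)
open import Relation.Unary using (Pred; Decidable)

-- The numbers `hom (H i) (H j)` do not in general form a triangular matrix: two graphs can map to
-- each other without being isomorphic. Hence the detour through embeddings. Expanding an embedding
-- count branches at pairs of vertices and repeats graphs, while a quantum graph must have few,
-- pairwise non-isomorphic constituents. So no expansion is ever written down: only membership in
-- the span, modulo `p`, of a fixed list of functions `hom G` is propagated, and that list alone
-- determines the size. The coefficients do not depend on the target graph, so one combination
-- serves all `H j`. They are natural numbers, with `pred p` in the role of -1. Ties in rank are
-- harmless: between distinct members of equal rank both embedding counts vanish, so a downward
-- induction on the rank inverts the matrix.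

private variable
  A B C : Set
  xs : List A

-- Counting by injections

unique-⊆⇒length≤ : {xs ys : List A} → Unique xs → xs ⊆ ys → length xs ≤ length ys
unique-⊆⇒length≤ [] _ = z≤n
unique-⊆⇒length≤ {xs = x ∷ xs} (x∉xs ∷ xs!) xs⊆ys with ∈-∃++ (xs⊆ys (here refl))
... | as , bs , refl = begin
  suc (length xs)          ≤⟨ s≤s (unique-⊆⇒length≤ xs! xs⊆as++bs) ⟩
  suc (length (as ++ bs))  ≡⟨ length-++-sucʳ as x bs ⟨
  length (as ++ x ∷ bs)    ∎
  where
  open ≤-Reasoning
  xs⊆as++bs : xs ⊆ as ++ bs
  xs⊆as++bs y∈xs with ∈-++⁻ as (xs⊆ys (there y∈xs))
  ... | inj₁ y∈as         = ∈-++⁺ˡ y∈as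
  ... | inj₂ (here refl)  = contradiction refl (All.lookup x∉xs y∈xs)
  ... | inj₂ (there y∈bs) = ∈-++⁺ʳ as y∈bs

-- If some `y` of `ys` were missing from `xs`, then `y ∷ xs` would be a repetition-free list inside
-- `ys` and longer than it.
unique-⊆-length≥⇒⊇ : DecidableEquality A → {xs ys : List A} → Unique xs → xs ⊆ ys →
                     length ys ≤ length xs → ys ⊆ xs
unique-⊆-length≥⇒⊇ _≟_ {xs} {ys} xs! xs⊆ys ∣ys∣≤∣xs∣ {y} y∈ys =
  decidable-stable (y ∈? xs) λ y∉xs →
    <⇒≱ (unique-⊆⇒length≤ (¬Any⇒All¬ xs y∉xs ∷ xs!) λ { (here refl) → y∈ys ; (there z∈xs) → xs⊆ys z∈xs }) ∣ys∣≤∣xs∣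
  where open DecMembership _≟_

unique-map : {xs : List A} (f : A → B) → (∀ {x y} → x ∈ xs → y ∈ xs → f x ≡ f y → x ≡ y) →
             Unique xs → Unique (map f xs)
unique-map f f-inj [] = []
unique-map f f-inj (x∉xs ∷ xs!) =
  All.tabulate (λ fy∈ fx≡z → let y , y∈xs , z≡fy = ∈-map⁻ f fy∈ in
    All.lookup x∉xs y∈xs (f-inj (here refl) (there y∈xs) (trans fx≡z z≡fy)))
  ∷ unique-map f (λ x∈ y∈ → f-inj (there x∈) (there y∈)) xs!

injection⇒length≤ : {xs : List A} {ys : List B} (f : A → B) → Unique xs →
                    (∀ {x y} → x ∈ xs → y ∈ xs → f x ≡ f y → x ≡ y) →
                    (∀ {x} → x ∈ xs → f x ∈ ys) → length xs ≤ length ys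
injection⇒length≤ {xs = xs} f xs! f-inj f∈ =
  ≤-trans (≤-reflexive (≡-sym (length-map f xs)))
    (unique-⊆⇒length≤ (unique-map f f-inj xs!)
      λ z∈ → let x , x∈xs , z≡fx = ∈-map⁻ f z∈ in subst (_∈ _) (≡-sym z≡fx) (f∈ x∈xs))

bijection⇒length≡ : {xs : List A} {ys : List B} (f : A → B) (g : B → A) → Unique xs → Unique ys →
                    (∀ {x} → x ∈ xs → f x ∈ ys) → (∀ {y} → y ∈ ys → g y ∈ xs) →
                    (∀ {x} → x ∈ xs → g (f x) ≡ x) → (∀ {y} → y ∈ ys → f (g y) ≡ y) →
                    length xs ≡ length ys
bijection⇒length≡ f g xs! ys! f∈ g∈ gf fg = ≤-antisym
  (injection⇒length≤ f xs! (λ x∈ y∈ eq → trans (≡-sym (gf x∈)) (trans (cong g eq) (gf y∈))) f∈)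
  (injection⇒length≤ g ys! (λ x∈ y∈ eq → trans (≡-sym (fg x∈)) (trans (cong f eq) (fg y∈))) g∈)

length-filter-¬ : {P : Pred A 0ℓ} (P? : Decidable P) (xs : List A) →
                  length (filter (¬? ∘ P?) xs) + length (filter P? xs) ≡ length xs
length-filter-¬ P? [] = refl
length-filter-¬ P? (x ∷ xs) with P? x
... | yes _ = trans (+-suc _ _) (cong suc (length-filter-¬ P? xs))
... | no  _ = cong suc (length-filter-¬ P? xs)

length-cartesianProductWith : (f : A → B → C) (xs : List A) (ys : List B) →
                              length (cartesianProductWith f xs ys) ≡ length xs * length ys
length-cartesianProductWith f []       ys = refl
length-cartesianProductWith f (x ∷ xs) ys = trans (length-++ (map (f x) ys))
  (cong₂ _+_ (length-map (f x) ys) (length-cartesianProductWith f xs ys))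

words : List A → (n : ℕ) → List (Vec A n)
words xs zero    = [ [] ]
words xs (suc n) = cartesianProductWith _∷_ xs (words xs n)

length-words : (xs : List A) (n : ℕ) → length (words xs n) ≡ length xs ^ n
length-words xs zero    = refl
length-words xs (suc n) = trans (length-cartesianProductWith _∷_ xs (words xs n))
  (cong (length xs *_) (length-words xs n))

words-unique : Unique xs → ∀ n → Unique (words xs n)
words-unique xs! zero    = [] ∷ []
words-unique xs! (suc n) = Unique.cartesianProductWith⁺ _∷_ Vec.∷-injective xs! (words-unique xs! n)

∈-words⁺ : ∀ {n} {v : Vec A n} → VAll.All (_∈ xs) v → v ∈ words xs n
∈-words⁺ []         = here refl
∈-words⁺ (px ∷ pxs) = ∈-cartesianProductWith⁺ _∷_ px (∈-words⁺ pxs)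

∈-words⁻ : ∀ n {v : Vec A n} → v ∈ words xs n → VAll.All (_∈ xs) v
∈-words⁻ zero {[]} _ = []
∈-words⁻ {xs = xs} (suc n) v∈ with ∈-cartesianProductWith⁻ _∷_ xs (words xs n) v∈
... | x , w , x∈xs , w∈ , refl = x∈xs ∷ ∈-words⁻ n w∈

-- Fixed points of maps of prime order

iter-+ : (f : A → A) (k l : ℕ) (x : A) → iter f (k + l) x ≡ iter f k (iter f l x)
iter-+ f zero    l x = refl
iter-+ f (suc k) l x = cong f (iter-+ f k l x)

iter-suc : (f : A → A) (k : ℕ) (x : A) → iter f (suc k) x ≡ iter f k (f x)
iter-suc f zero    x = refl
iter-suc f (suc k) x = cong f (iter-suc f k x)

iter-*-fixed : (f : A → A) (k : ℕ) {l : ℕ} {x : A} → iter f l x ≡ x → iter f (k * l) x ≡ x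
iter-*-fixed f zero    fix = refl
iter-*-fixed f (suc k) {l} {x} fix =
  trans (iter-+ f l (k * l) x) (trans (cong (iter f l) (iter-*-fixed f k fix)) fix)

-- A multiple of `k` and a multiple of `l` differ by one, and both iterates fix `x`. Over ℕ the
-- Bézout identity has one case per sign.
iter-coprime-fixed : (f : A → A) {k l : ℕ} {x : A} → Bézout.Identity 1 k l →
                     iter f k x ≡ x → iter f l x ≡ x → f x ≡ x
iter-coprime-fixed f {k} {l} {x} (Bézout.+- a b eq) fixₖ fixₗ = begin
  f x                    ≡⟨ cong f (iter-*-fixed f b fixₗ) ⟨
  iter f (1 + b * l) x   ≡⟨ cong (λ m → iter f m x) eq ⟩
  iter f (a * k) x       ≡⟨ iter-*-fixed f a fixₖ ⟩
  x                      ∎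
  where open ≡-Reasoning
iter-coprime-fixed f {k} {l} {x} (Bézout.-+ a b eq) fixₖ fixₗ = begin
  f x                    ≡⟨ cong f (iter-*-fixed f a fixₖ) ⟨
  iter f (1 + a * k) x   ≡⟨ cong (λ m → iter f m x) eq ⟩
  iter f (b * l) x       ≡⟨ iter-*-fixed f b fixₗ ⟩
  x                      ∎
  where open ≡-Reasoning

module _ (_≟_ : DecidableEquality A) (σ : A → A) (q : ℕ) (p-prime : Prime (suc q))
         (σ-order : ∀ x → iter σ (suc q) x ≡ x) where

  open DecMembership _≟_ using (_∈?_)

  private
    p = suc q

  orbit : A → List A
  orbit x = applyUpTo (λ i → iter σ i x) p

  σ-injective : ∀ {x y} → σ x ≡ σ y → x ≡ y
  σ-injective {x} {y} eq = begin
    x                ≡⟨ iter-σ x ⟨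
    iter σ q (σ x)   ≡⟨ cong (iter σ q) eq ⟩
    iter σ q (σ y)   ≡⟨ iter-σ y ⟩
    y                ∎
    where
    open ≡-Reasoning
    iter-σ : ∀ z → iter σ q (σ z) ≡ z
    iter-σ z = trans (≡-sym (iter-suc σ q z)) (σ-order z)

  iter-injective : ∀ k {x y} → iter σ k x ≡ iter σ k y → x ≡ y
  iter-injective zero    eq = eq
  iter-injective (suc k) eq = iter-injective k (σ-injective eq)

  -- A repetition at `i < j` makes `iter σ (j ∸ i)` fix `x`. Since `0 < j ∸ i < p`, this exponent is
  -- coprime to `p`, so `σ` itself would fix `x`.
  orbit-unique : ∀ {x} → σ x ≢ x → Unique (orbit x)
  orbit-unique {x} σx≢x = Unique.applyUpTo⁺₁ (λ i → iter σ i x) p λ {i} {j} i<j j<p eq →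
    σx≢x (iter-coprime-fixed σ
      (coprime-Bézout (prime⇒coprime p-prime {{>-nonZero (m<n⇒0<n∸m i<j)}} (≤-<-trans (m∸n≤m j i) j<p)))
      (σ-order x)
      (≡-sym (iter-injective i (begin
        iter σ i x                      ≡⟨ eq ⟩
        iter σ j x                      ≡⟨ cong (λ m → iter σ m x) (m+[n∸m]≡n (<⇒≤ i<j)) ⟨
        iter σ (i + (j ∸ i)) x          ≡⟨ iter-+ σ i (j ∸ i) x ⟩
        iter σ i (iter σ (j ∸ i) x)     ∎))))
    where open ≡-Reasoning

  -- Stability of the orbit under predecessors is what makes its complement `Closed`.
  orbit-pred : ∀ {x y} → σ y ∈ orbit x → y ∈ orbit x
  orbit-pred {x} σy∈ with ∈-applyUpTo⁻ (λ i → iter σ i x) σy∈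
  -- Here `σ y` is `x` itself, so `y` is the last point `iter σ q x` of the orbit.
  ... | zero  , i<p , eq = subst (_∈ orbit x) (σ-injective (trans (σ-order x) (≡-sym eq)))
                             (∈-applyUpTo⁺ (λ i → iter σ i x) {q} ≤-refl)
  ... | suc i , i<p , eq = subst (_∈ orbit x) (≡-sym (σ-injective eq))
                             (∈-applyUpTo⁺ (λ i → iter σ i x) (<⇒≤ i<p))

  Closed : List A → Set
  Closed xs = ∀ {x} → x ∈ xs → σ x ∈ xs

  orbit⊆closed : ∀ {x xs} → Closed xs → x ∈ xs → orbit x ⊆ xs
  orbit⊆closed {x} {xs} closed x∈xs y∈ with ∈-applyUpTo⁻ (λ i → iter σ i x) y∈
  ... | i , _ , refl = iter∈ i
    where
    iter∈ : ∀ i → iter σ i x ∈ xs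
    iter∈ zero    = x∈xs
    iter∈ (suc i) = closed (iter∈ i)

  -- The orbit of the head has exactly `p` elements. Removing it leaves a closed list that is
  -- shorter but not a structural subterm, hence the `Acc` argument.
  fixed-point-free⇒∣length : ∀ xs → Acc _<_ (length xs) → Unique xs → Closed xs →
                             (∀ {x} → x ∈ xs → σ x ≢ x) → p ∣ length xs
  fixed-point-free⇒∣length []            _         _   _      _    = p ∣0
  fixed-point-free⇒∣length xs@(x ∷ xs′) (acc rec) xs! closed free =
    subst (p ∣_) split (∣m∣n⇒∣m+n ∣-refl
      (fixed-point-free⇒∣length rest (rec rest<xs) (Unique.filter⁺ outside? xs!) rest-closed
        (free ∘ proj₁ ∘ ∈-filter⁻ outside?)))
    where
    outside? : Decidable (_∉ orbit x)
    outside? y = ¬? (y ∈? orbit x)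

    rest : List A
    rest = filter outside? xs

    rest-closed : Closed rest
    rest-closed y∈rest = let y∈xs , y∉orbit = ∈-filter⁻ outside? y∈rest in
      ∈-filter⁺ outside? (closed y∈xs) (y∉orbit ∘ orbit-pred)

    inside : length (filter (_∈? orbit x) xs) ≡ p
    inside = trans
      (bijection⇒length≡ id id (Unique.filter⁺ (_∈? orbit x) xs!) (orbit-unique (free (here refl)))
        (proj₂ ∘ ∈-filter⁻ (_∈? orbit x) {xs = xs})
        (λ y∈ → ∈-filter⁺ (_∈? orbit x) (orbit⊆closed closed (here refl) y∈) y∈)
        (λ _ → refl) (λ _ → refl))
      (length-applyUpTo (λ i → iter σ i x) p)

    split : p + length rest ≡ length xs
    split = trans (+-comm p (length rest))
      (trans (cong (length rest +_) (≡-sym inside)) (length-filter-¬ (_∈? orbit x) xs))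

    rest<xs : length rest < length xs
    rest<xs = subst (length rest <_) split (m<n+m (length rest) (s≤s z≤n))

  ∣length⇒∣fixed : ∀ {xs} → Unique xs → Closed xs → p ∣ length xs →
                   p ∣ length (filter (λ x → σ x ≟ x) xs)
  ∣length⇒∣fixed {xs} xs! closed p∣xs = ∣m+n∣m⇒∣n
    (subst (p ∣_) (≡-sym (length-filter-¬ fixed? xs)) p∣xs)
    (fixed-point-free⇒∣length (filter moved? xs) (<-wellFounded _) (Unique.filter⁺ moved? xs!)
      (λ x∈ → let x∈xs , moved = ∈-filter⁻ moved? x∈ in
        ∈-filter⁺ moved? (closed x∈xs) (moved ∘ σ-injective))
      (proj₂ ∘ ∈-filter⁻ moved? {xs = xs}))
    where
    fixed? moved? : Decidable _
    fixed? x = σ x ≟ x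
    moved? = ¬? ∘ fixed?

-- Cauchy's theorem

rotate : ∀ {n} → Vec A n → Vec A n
rotate []      = []
rotate (x ∷ v) = v ∷ʳ x

-- The prefix `xs` holds the letters still to be moved, and `ys` collects those already moved. On
-- lists the cut `xs ++ ys` causes no reindexing of vector lengths.
toList-iter-rotate : ∀ (xs ys : List A) {n} (v : Vec A n) → toList v ≡ xs ++ ys →
                     toList (iter rotate (length xs) v) ≡ ys ++ xs
toList-iter-rotate []       ys v eq = trans eq (≡-sym (++-identityʳ ys))
toList-iter-rotate (x ∷ xs) ys (y ∷ v) eq with List.∷-injective eq
... | refl , eq′ = begin
  toList (iter rotate (suc (length xs)) (x ∷ v))  ≡⟨ cong toList (iter-suc rotate (length xs) (x ∷ v)) ⟩
  toList (iter rotate (length xs) (v ∷ʳ x))       ≡⟨ toList-iter-rotate xs (ys ++ [ x ]) (v ∷ʳ x) rotated ⟩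
  (ys ++ [ x ]) ++ xs                             ≡⟨ ++-assoc ys [ x ] xs ⟩
  ys ++ x ∷ xs                                    ∎
  where
  open ≡-Reasoning
  rotated : toList (v ∷ʳ x) ≡ xs ++ ys ++ [ x ]
  rotated = trans (Vec.toList-∷ʳ x v) (trans (cong (_++ [ x ]) eq′) (++-assoc xs ys [ x ]))

iter-rotate : ∀ {n} (v : Vec A n) → iter rotate n v ≡ v
iter-rotate {n = n} v = trans (≡-sym (Vec.cast-is-id refl (iter rotate n v))) (Vec.toList-injective refl (iter rotate n v) v
  (subst (λ k → toList (iter rotate k v) ≡ toList v) (Vec.length-toList v)
    (toList-iter-rotate (toList v) [] v (≡-sym (++-identityʳ (toList v))))))

∷ʳ≡∷⇒replicate : ∀ {n} (x : A) (v : Vec A n) → v ∷ʳ x ≡ x ∷ v → v ≡ replicate n x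
∷ʳ≡∷⇒replicate x []      eq = refl
∷ʳ≡∷⇒replicate x (y ∷ v) eq with Vec.∷-injective eq
... | refl , eq′ = cong (x ∷_) (∷ʳ≡∷⇒replicate x v eq′)

all-∷ʳ⁺ : ∀ {n} {P : Pred A 0ℓ} {v : Vec A n} {x} → VAll.All P v → P x → VAll.All P (v ∷ʳ x)
all-∷ʳ⁺ []         px = px ∷ []
all-∷ʳ⁺ (py ∷ pys) px = py ∷ all-∷ʳ⁺ pys px

∣^⇒suc : ∀ {p m} n → p ∣ m → p ∣ m ^ suc n
∣^⇒suc {m = m} n p∣m = ∣-trans p∣m (m∣m*n (m ^ n))

-- The group is a list `G` inside an ambient monoid, with inverses only for members of `G`:
-- automorphisms will be such a list in the monoid of all self-maps of the vertex set.
module _ (_≟_ : DecidableEquality A) {_∙_ : A → A → A} {ε : A} (monoid : IsMonoid _≡_ _∙_ ε)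
         (_⁻¹ : A → A) {G : List A} (G! : Unique G) (ε∈G : ε ∈ G)
         (∙-closed : ∀ {g h} → g ∈ G → h ∈ G → (g ∙ h) ∈ G)
         (⁻¹-closed : ∀ {g} → g ∈ G → (g ⁻¹) ∈ G)
         (inverseˡ : ∀ {g} → g ∈ G → ((g ⁻¹) ∙ g) ≡ ε) where

  open IsMonoid monoid using (assoc; identityˡ; identityʳ)

  prod : ∀ {n} → Vec A n → A
  prod = Vec.foldr′ _∙_ ε

  prod-∷ʳ : ∀ {n} (v : Vec A n) g → prod (v ∷ʳ g) ≡ prod v ∙ g
  prod-∷ʳ []      g = trans (identityʳ g) (≡-sym (identityˡ g))
  prod-∷ʳ (h ∷ v) g = trans (cong (h ∙_) (prod-∷ʳ v g)) (≡-sym (assoc h (prod v) g))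

  prod-closed : ∀ {n} {v : Vec A n} → VAll.All (_∈ G) v → prod v ∈ G
  prod-closed []       = ε∈G
  prod-closed (g∈ ∷ v∈) = ∙-closed g∈ (prod-closed v∈)

  inverse-unique : ∀ {g h} → g ∈ G → (g ∙ h) ≡ ε → h ≡ (g ⁻¹)
  inverse-unique {g} {h} g∈G gh≡ε = begin
    h                  ≡⟨ identityˡ h ⟨
    ε ∙ h              ≡⟨ cong (_∙ h) (inverseˡ g∈G) ⟨
    ((g ⁻¹) ∙ g) ∙ h   ≡⟨ assoc (g ⁻¹) g h ⟩
    (g ⁻¹) ∙ (g ∙ h)   ≡⟨ cong ((g ⁻¹) ∙_) gh≡ε ⟩
    (g ⁻¹) ∙ ε         ≡⟨ identityʳ (g ⁻¹) ⟩
    g ⁻¹               ∎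
    where open ≡-Reasoning

  -- If `g ∙ prod v` is `ε`, then `prod v` is the inverse of `g`, and a left inverse is all that the
  -- rotated product requires.
  prod-rotate : ∀ {n} (v : Vec A n) → VAll.All (_∈ G) v → prod v ≡ ε → prod (rotate v) ≡ ε
  prod-rotate []      _          eq = eq
  prod-rotate (g ∷ v) (g∈G ∷ _) eq = begin
    prod (v ∷ʳ g)   ≡⟨ prod-∷ʳ v g ⟩
    prod v ∙ g      ≡⟨ cong (_∙ g) (inverse-unique g∈G eq) ⟩
    (g ⁻¹) ∙ g      ≡⟨ inverseˡ g∈G ⟩
    ε               ∎
    where open ≡-Reasoning

  -- McKay's proof: rotation acts on the |G|^q words of length q + 1 with product ε,
  -- and its fixed points are the constant words.
  cauchy : ∀ {q} → Prime (suc (suc q)) →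
           (∀ {g} → g ∈ G → prod (replicate (2 + q) g) ≡ ε → g ≡ ε) → ¬ (2 + q) ∣ length G
  cauchy {q} p-prime no-order-p p∣∣G∣ = contradiction (∣1⇒≡1 p∣1) λ ()
    where
    p = 2 + q

    _≟ᵥ_ : DecidableEquality (Vec A p)
    _≟ᵥ_ = Vec.≡-dec _≟_

    trivial? : Decidable (λ v → prod v ≡ ε)
    trivial? v = prod v ≟ ε

    X : List (Vec A p)
    X = filter trivial? (words G p)

    X! : Unique X
    X! = Unique.filter⁺ trivial? (words-unique G! p)

    X⁻ : ∀ {v} → v ∈ X → VAll.All (_∈ G) v × prod v ≡ ε
    X⁻ v∈X = let v∈ , eq = ∈-filter⁻ trivial? v∈X in ∈-words⁻ p v∈ , eq

    X⁺ : ∀ {v} → VAll.All (_∈ G) v → prod v ≡ ε → v ∈ X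
    X⁺ v∈G eq = ∈-filter⁺ trivial? (∈-words⁺ v∈G) eq

    -- The last `suc q` letters are free and force the first one, which counts `X`.
    complete : Vec A (suc q) → Vec A p
    complete v = (prod v ⁻¹) ∷ v

    ∣X∣ : length X ≡ length G ^ suc q
    ∣X∣ = trans (bijection⇒length≡ Vec.tail complete X! (words-unique G! (suc q))
        (λ { {g ∷ v} v∈X → ∈-words⁺ (VAll.tail (proj₁ (X⁻ v∈X))) })
        (λ {v} v∈ → let v∈G = prod-closed (∈-words⁻ (suc q) v∈) in
          X⁺ (⁻¹-closed v∈G ∷ ∈-words⁻ (suc q) v∈) (inverseˡ v∈G))
        (λ { {g ∷ v} v∈X → cong (_∷ v) (≡-sym (inverse-unique′ (X⁻ v∈X))) })
        (λ _ → refl))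
      (length-words G (suc q))
      where
      inverse-unique′ : ∀ {g v} → VAll.All (_∈ G) (g ∷ v) × prod (g ∷ v) ≡ ε → g ≡ (prod v ⁻¹)
      inverse-unique′ {g} {v} (g∈G ∷ v∈G , eq) = inverse-unique (prod-closed v∈G)
        (trans (cong (_∙ g) (inverse-unique g∈G eq)) (inverseˡ g∈G))

    fixed? : Decidable (λ v → rotate v ≡ v)
    fixed? v = rotate v ≟ᵥ v

    -- The exponent `suc q` of `length G` is positive because `p` is at least 2, so divisibility
    -- passes from `length G` to `length X`.
    p∣fixed : p ∣ length (filter fixed? X)
    p∣fixed = ∣length⇒∣fixed _≟ᵥ_ rotate (suc q) p-prime iter-rotate X!
      (λ { {v@(g ∷ w)} v∈X → let v∈G , eq = X⁻ v∈X in
           X⁺ (all-∷ʳ⁺ (VAll.tail v∈G) (VAll.head v∈G)) (prod-rotate v v∈G eq) })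
      (subst (p ∣_) (≡-sym ∣X∣) (∣^⇒suc q p∣∣G∣))

    εs : Vec A p
    εs = replicate p ε

    prod-εs : ∀ n → prod (replicate n ε) ≡ ε
    prod-εs zero    = refl
    prod-εs (suc n) = trans (identityˡ _) (prod-εs n)

    all-replicate : ∀ n → VAll.All (_∈ G) (replicate n ε)
    all-replicate zero    = []
    all-replicate (suc n) = ε∈G ∷ all-replicate n

    replicate-∷ʳ : ∀ n → replicate n ε ∷ʳ ε ≡ ε ∷ replicate n ε
    replicate-∷ʳ zero    = refl
    replicate-∷ʳ (suc n) = cong (ε ∷_) (replicate-∷ʳ n)

    fixed⇒εs : ∀ {v} → v ∈ filter fixed? X → v ≡ εs
    fixed⇒εs {g ∷ v} v∈ with ∈-filter⁻ fixed? {xs = X} v∈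
    ... | v∈X , eq with ∷ʳ≡∷⇒replicate g v eq | X⁻ v∈X
    ... | refl | g∈G ∷ _ , prod≡ε = cong (replicate p) (no-order-p g∈G prod≡ε)

    ∣fixed∣≡1 : length (filter fixed? X) ≡ 1
    ∣fixed∣≡1 = bijection⇒length≡ {ys = [ εs ]} id id (Unique.filter⁺ fixed? X!) ([] ∷ [])
      (λ v∈ → here (fixed⇒εs v∈))
      (λ { (here refl) → ∈-filter⁺ fixed? (X⁺ (all-replicate p) (prod-εs p)) (replicate-∷ʳ (suc q)) })
      (λ _ → refl) (λ _ → refl)

    p∣1 : p ∣ 1
    p∣1 = subst (p ∣_) ∣fixed∣≡1 p∣fixed

-- Homomorphisms as vectors

lookup-injective : ∀ {A : Set} {k} {v w : Vec A k} → (∀ i → lookup v i ≡ lookup w i) → v ≡ w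
lookup-injective {v = v} {w} eq =
  trans (≡-sym (Vec.tabulate∘lookup v)) (trans (Vec.tabulate-cong eq) (Vec.tabulate∘lookup w))

allFins-unique : ∀ b → Unique (allFins b)
allFins-unique zero    = []
allFins-unique (suc b) =
  All.tabulate (λ 1+i∈ 0≡1+i → let i , _ , eq = ∈-map⁻ Fin.suc 1+i∈ in
    contradiction (trans 0≡1+i eq) λ ())
  ∷ Unique.map⁺ Fin.suc-injective (allFins-unique b)

∈-allFins : ∀ {b} (i : Fin b) → i ∈ allFins b
∈-allFins Fin.zero    = here refl
∈-allFins (Fin.suc i) = there (∈-map⁺ Fin.suc (∈-allFins i))

length-allFins : ∀ b → length (allFins b) ≡ b
length-allFins zero    = refl
length-allFins (suc b) = cong suc (trans (length-map Fin.suc (allFins b)) (length-allFins b))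

tabulate-allFuns : ∀ a b → map tabulate (allFuns a b) ≡ words (allFins b) a
tabulate-allFuns zero    b = refl
tabulate-allFuns (suc a) b = go (allFins b)
  where
  open ≡-Reasoning
  go : ∀ xs → map tabulate (concatMap (λ x → map (extend x) (allFuns a b)) xs)
              ≡ cartesianProductWith _∷_ xs (words (allFins b) a)
  go []       = refl
  go (x ∷ xs) = begin
    map tabulate (map (extend x) fs ++ rest)
      ≡⟨ map-++ tabulate (map (extend x) fs) rest ⟩
    map tabulate (map (extend x) fs) ++ map tabulate rest
      ≡⟨ cong₂ _++_ (trans (≡-sym (map-∘ fs)) (trans (map-∘ fs) (cong (map (x ∷_)) (tabulate-allFuns a b)))) (go xs) ⟩
    map (x ∷_) (words (allFins b) a) ++ cartesianProductWith _∷_ xs (words (allFins b) a) ∎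
    where
    fs   = allFuns a b
    rest = concatMap (λ x → map (extend x) (allFuns a b)) xs

isHom-cong : ∀ G H {f g} → (∀ u → f u ≡ g u) → IsHom G H f → IsHom G H g
isHom-cong G H eq f-hom u v uv = subst₂′ (eq u) (eq v) (f-hom u v uv)
  where
  subst₂′ : ∀ {x x′ y y′} → x ≡ x′ → y ≡ y′ → Edge H x y → Edge H x′ y′
  subst₂′ refl refl e = e

-- Vectors replace functions because their propositional equality is decidable and agrees with
-- pointwise equality, so bijections between sets of homomorphisms can be proved.
homs : (G H : Graph) → List (Vec (Fin (n H)) (n G))
homs G H = map tabulate (filter (isHom? G H) (allFuns (n G) (n H)))

length-homs : ∀ G H → length (homs G H) ≡ hom G H
length-homs G H = length-map tabulate (filter (isHom? G H) (allFuns (n G) (n H)))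

homs-unique : ∀ G H → Unique (homs G H)
homs-unique G H = AllPairs.map⁺ (AllPairs.filter⁺ (isHom? G H) (AllPairs.map⁻
  (subst Unique (≡-sym (tabulate-allFuns (n G) (n H))) (words-unique (allFins-unique (n H)) (n G)))))

∈-homs⁻ : ∀ G H {v} → v ∈ homs G H → IsHom G H (lookup v)
∈-homs⁻ G H v∈ with ∈-map⁻ tabulate v∈
... | f , f∈ , refl = isHom-cong G H (λ u → ≡-sym (Vec.lookup∘tabulate f u))
  (proj₂ (∈-filter⁻ (isHom? G H) {xs = allFuns (n G) (n H)} f∈))

∈-homs⁺ : ∀ G H {v} → IsHom G H (lookup v) → v ∈ homs G H
∈-homs⁺ G H {v} v-hom with ∈-map⁻ tabulate
  (subst (v ∈_) (≡-sym (tabulate-allFuns (n G) (n H))) (∈-words⁺ (VAll.universal ∈-allFins v)))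
... | f , f∈ , refl = ∈-map⁺ tabulate (∈-filter⁺ (isHom? G H) f∈
  (isHom-cong G H (Vec.lookup∘tabulate f) v-hom))

iso-hom : ∀ {G H} (i : Iso G H) → IsHom G H (Iso.to i)
iso-hom i u v uv = trans (≡-sym (Iso.pres i u v)) uv

iso-refl : ∀ {G} → Iso G G
iso-refl = record
  { to = id ; from = id ; from-to = λ _ → refl ; to-from = λ _ → refl ; pres = λ _ _ → refl }

iso-sym : ∀ {G H} → Iso G H → Iso H G
iso-sym {G} {H} i = record
  { to = from ; from = to ; from-to = to-from ; to-from = from-to
  ; pres = λ u v → ≡-sym (trans (pres (from u) (from v)) (cong₂ (adj H) (to-from u) (to-from v))) }
  where open Iso i

iso-trans : ∀ {G H K} → Iso G H → Iso H K → Iso G K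
iso-trans i j = record
  { to      = J.to ∘ I.to
  ; from    = I.from ∘ J.from
  ; from-to = λ u → trans (cong I.from (J.from-to (I.to u))) (I.from-to u)
  ; to-from = λ v → trans (cong J.to (I.to-from (J.from v))) (J.to-from v)
  ; pres    = λ u v → trans (I.pres u v) (J.pres (I.to u) (I.to v)) }
  where
  module I = Iso i
  module J = Iso j

isHom-∘ : ∀ {G H} K {f g} → IsHom G H f → IsHom H K g → IsHom G K (g ∘ f)
isHom-∘ K f-hom g-hom u v = g-hom _ _ ∘ f-hom u v

hom-resp-iso : ∀ {F G} H → Iso F G → hom F H ≡ hom G H
hom-resp-iso {F} {G} H i =
  trans (≡-sym (length-homs F H)) (trans
    (bijection⇒length≡ (pull from) (pull to) (homs-unique F H) (homs-unique G H)
      (λ v∈ → pull-hom G F (iso-hom (iso-sym i)) v∈)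
      (λ v∈ → pull-hom F G (iso-hom i) v∈)
      (λ {v} _ → pull-pull {f = to} {from} from-to v)
      (λ {v} _ → pull-pull {f = from} {to} to-from v))
    (length-homs G H))
  where
  open Iso i
  pull : ∀ {a b} → (Fin b → Fin a) → Vec (Fin (n H)) a → Vec (Fin (n H)) b
  pull f v = tabulate (lookup v ∘ f)
  pull-hom : ∀ F G {f : Fin (n F) → Fin (n G)} {v} → IsHom F G f → v ∈ homs G H → pull f v ∈ homs F H
  pull-hom F G {f} {v} f-hom v∈ = ∈-homs⁺ F H
    (isHom-cong F H (λ u → ≡-sym (Vec.lookup∘tabulate (lookup v ∘ f) u))
      (isHom-∘ {F} {G} H f-hom (∈-homs⁻ G H v∈)))
  pull-pull : ∀ {a b} {f : Fin a → Fin b} {g : Fin b → Fin a} → (∀ x → g (f x) ≡ x) →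
              ∀ v → pull f (pull g v) ≡ v
  pull-pull {f = f} {g} gf v = lookup-injective λ x →
    trans (Vec.lookup∘tabulate (lookup (pull g v) ∘ f) x)
      (trans (Vec.lookup∘tabulate (lookup v ∘ g) (f x)) (cong (lookup v) (gf x)))

-- Embeddings

Inj : ∀ {a b} → (Fin a → Fin b) → Set
Inj f = ∀ {u v} → f u ≡ f v → u ≡ v

_↪_ : Graph → Graph → Set
G ↪ H = ∃ λ f → IsHom G H f × Inj f

_≟₂_ : ∀ {k} → DecidableEquality (Fin k × Fin k)
_≟₂_ = Product.≡-dec _≟_ _≟_

pairs : ∀ k → List (Fin k × Fin k)
pairs k = cartesianProduct (allFins k) (allFins k)

∈-pairs : ∀ {k} (e : Fin k × Fin k) → e ∈ pairs k
∈-pairs (u , v) = ∈-cartesianProduct⁺ (∈-allFins u) (∈-allFins v)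

edge? : ∀ G → Decidable (uncurry (Edge G))
edge? G (u , v) = adj G u v Bool.≟ true

edges : (G : Graph) → List (Fin (n G) × Fin (n G))
edges G = filter (edge? G) (pairs (n G))

edges-unique : ∀ G → Unique (edges G)
edges-unique G = Unique.filter⁺ (edge? G)
  (Unique.cartesianProduct⁺ (allFins-unique (n G)) (allFins-unique (n G)))

∈-edges⁺ : ∀ G {u v} → Edge G u v → (u , v) ∈ edges G
∈-edges⁺ G uv = ∈-filter⁺ (edge? G) (∈-pairs _) uv

∈-edges⁻ : ∀ G {u v} → (u , v) ∈ edges G → Edge G u v
∈-edges⁻ G e∈ = proj₂ (∈-filter⁻ (edge? G) {xs = pairs (n G)} e∈)

-- `edges` lists ordered pairs, so a non-loop edge counts twice. Only comparisons of ranks matter.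
rank : Graph → ℕ
rank G = n G + length (edges G)

rank≤ : ∀ G → rank G ≤ n G + n G * n G
rank≤ G = +-monoʳ-≤ (n G) (≤-trans (length-filter (edge? G) (pairs (n G)))
  (≤-reflexive (trans (length-cartesianProductWith _,_ (allFins (n G)) (allFins (n G)))
    (cong₂ _*_ (length-allFins (n G)) (length-allFins (n G))))))

injection⇒surjection : ∀ {A B : Set} → DecidableEquality B → {xs : List A} {ys : List B} (f : A → B) →
                       Unique xs → (∀ {x y} → x ∈ xs → y ∈ xs → f x ≡ f y → x ≡ y) →
                       (∀ {x} → x ∈ xs → f x ∈ ys) → length ys ≤ length xs →
                       ∀ {y} → y ∈ ys → ∃ λ x → x ∈ xs × y ≡ f x
injection⇒surjection _≟_ {xs} f xs! f-inj f∈ ∣ys∣≤∣xs∣ y∈ys = ∈-map⁻ f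
  (unique-⊆-length≥⇒⊇ _≟_ (unique-map f f-inj xs!)
    (λ z∈ → let x , x∈xs , z≡fx = ∈-map⁻ f z∈ in subst (_∈ _) (≡-sym z≡fx) (f∈ x∈xs))
    (≤-trans ∣ys∣≤∣xs∣ (≤-reflexive (≡-sym (length-map f xs)))) y∈ys)

module _ {G H : Graph} {f : Fin (n G) → Fin (n H)} (f-hom : IsHom G H f) (f-inj : Inj f) where

  private
    f² : Fin (n G) × Fin (n G) → Fin (n H) × Fin (n H)
    f² = Product.map f f

    f²-inj : ∀ {d e} → f² d ≡ f² e → d ≡ e
    f²-inj eq = cong₂ _,_ (f-inj (cong proj₁ eq)) (f-inj (cong proj₂ eq))

    f²∈ : ∀ {e} → e ∈ edges G → f² e ∈ edges H
    f²∈ {u , v} e∈ = ∈-edges⁺ H (f-hom u v (∈-edges⁻ G e∈))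

    vertices≤ : n G ≤ n H
    vertices≤ = injective⇒≤ f-inj

    edges≤ : length (edges G) ≤ length (edges H)
    edges≤ = injection⇒length≤ f² (edges-unique G) (λ _ _ → f²-inj) f²∈

  embedding⇒rank≤ : rank G ≤ rank H
  embedding⇒rank≤ = +-mono-≤ vertices≤ edges≤

  module _ (rank≥ : rank H ≤ rank G) where

    private
      -- Each summand of `rank G` is at most its counterpart in `rank H`, so `rank≥` forces equality
      -- in both.
      vertices≥ : n H ≤ n G
      vertices≥ = +-cancelʳ-≤ (length (edges H)) (n H) (n G)
        (≤-trans rank≥ (+-monoʳ-≤ (n G) edges≤))

      edges≥ : length (edges H) ≤ length (edges G)
      edges≥ = +-cancelˡ-≤ (n H) (length (edges H)) (length (edges G))
        (≤-trans rank≥ (+-monoˡ-≤ (length (edges G)) vertices≤))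

    embedding⇒surjective : ∀ y → ∃ λ x → y ≡ f x
    embedding⇒surjective y = let x , _ , eq = onto in x , eq
      where
      onto : ∃ λ x → x ∈ allFins (n G) × y ≡ f x
      onto = injection⇒surjection _≟_ f (allFins-unique (n G)) (λ _ _ → f-inj)
        (λ _ → ∈-allFins _)
        (≤-trans (≤-reflexive (length-allFins (n H)))
          (≤-trans vertices≥ (≤-reflexive (≡-sym (length-allFins (n G))))))
        (∈-allFins y)

    -- `f²` injects one edge list into another of the same length, so it is onto. The edge above
    -- `(f u , f v)` can only be `(u , v)`, as `f²` is injective.
    reflects-edges : ∀ u v → Edge H (f u) (f v) → Edge G u v
    reflects-edges u v fufv = let e , e∈ , eq = onto in
      ∈-edges⁻ G (subst (_∈ edges G) (≡-sym (f²-inj eq)) e∈)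
      where
      onto : ∃ λ e → e ∈ edges G × f² (u , v) ≡ f² e
      onto = injection⇒surjection _≟₂_ f² (edges-unique G) (λ _ _ → f²-inj) f²∈ edges≥ (∈-edges⁺ H fufv)

    embedding⇒iso : Iso G H
    embedding⇒iso = record
      { to      = f
      ; from    = proj₁ ∘ embedding⇒surjective
      ; from-to = λ u → ≡-sym (f-inj (proj₂ (embedding⇒surjective (f u))))
      ; to-from = λ y → ≡-sym (proj₂ (embedding⇒surjective y))
      ; pres    = pres }
      where
      pres : ∀ u v → adj G u v ≡ adj H (f u) (f v)
      pres u v with adj G u v in uv | adj H (f u) (f v) in fufv
      ... | true  | true  = refl
      ... | false | false = refl
      ... | true  | false = trans (≡-sym (f-hom u v uv)) fufv
      ... | false | true  = trans (≡-sym uv) (reflects-edges u v fufv)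

iso⇒embedding : ∀ {G H} → Iso G H → G ↪ H
iso⇒embedding i = to , iso-hom i , λ eq → trans (≡-sym (from-to _)) (trans (cong from eq) (from-to _))
  where open Iso i

inj? : ∀ {a b} (f : Fin a → Fin b) → Dec (Inj f)
inj? f = map′ (λ inj {u} {v} → inj u v) (λ inj u v → inj {u} {v})
  (all? λ u → all? λ v → (f u ≟ f v) →-dec (u ≟ v))

embedding? : ∀ G H → Dec (G ↪ H)
embedding? G H with Any.any? (inj? ∘ lookup) (homs G H)
... | yes some = let v , v∈ , v-inj = find some in yes (lookup v , ∈-homs⁻ G H v∈ , v-inj)
... | no none = no λ (f , f-hom , f-inj) →
  none (lose
    (∈-homs⁺ G H {tabulate f} (isHom-cong G H (λ u → ≡-sym (Vec.lookup∘tabulate f u)) f-hom))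
    λ {u} {v} eq → f-inj (trans (≡-sym (Vec.lookup∘tabulate f u)) (trans eq (Vec.lookup∘tabulate f v))))

-- A finite Cantor-Bernstein argument: the second embedding supplies the rank inequality that turns
-- the first into an isomorphism.
iso? : ∀ G H → Dec (Iso G H)
iso? G H with embedding? G H | embedding? H G
... | yes (f , f-hom , f-inj) | yes (g , g-hom , g-inj) =
  yes (embedding⇒iso f-hom f-inj (embedding⇒rank≤ {H} {G} g-hom g-inj))
... | no ¬f | _     = no (¬f ∘ iso⇒embedding)
... | _     | no ¬g = no (¬g ∘ iso⇒embedding ∘ iso-sym)

-- Contraction of a pair of vertices

map-edge? : ∀ F {m} (π : Fin (n F) → Fin m) (x y : Fin m) →
            Dec (∃ λ u → ∃ λ v → π u ≡ x × π v ≡ y × Edge F u v)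
map-edge? F π x y = any? λ u → any? λ v → (π u ≟ x) ×-dec (π v ≟ y) ×-dec edge? F (u , v)

-- For surjective `π`, the quotient of `F` along `π`. Merging adjacent vertices leaves a loop, which
-- `Graph` allows.
image : (F : Graph) {m : ℕ} → (Fin (n F) → Fin m) → Graph
image F {m} π = record
  { n   = m
  ; adj = λ x y → does (map-edge? F π x y)
  ; sym = λ x y → does-⇔ (mk⇔ flip-edge flip-edge) (map-edge? F π x y) (map-edge? F π y x) }
  where
  flip-edge : ∀ {x y} → (∃ λ u → ∃ λ v → π u ≡ x × π v ≡ y × Edge F u v) →
              ∃ λ u → ∃ λ v → π u ≡ y × π v ≡ x × Edge F u v
  flip-edge (u , v , πu , πv , uv) = v , u , πv , πu , trans (sym F v u) uv

does⇒ : ∀ {P : Set} (P? : Dec P) → does P? ≡ true → P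
does⇒ (yes p) _ = p

image-hom⁺ : ∀ F H {m} (π : Fin (n F) → Fin m) {g} → IsHom F H (g ∘ π) → IsHom (image F π) H g
image-hom⁺ F H π g-hom x y xy with does⇒ (map-edge? F π x y) xy
... | u , v , refl , refl , uv = g-hom u v uv

image-hom⁻ : ∀ F H {m} (π : Fin (n F) → Fin m) {g} → IsHom (image F π) H g → IsHom F H (g ∘ π)
image-hom⁻ F H π g-hom u v uv = g-hom (π u) (π v)
  (dec-true (map-edge? F π (π u) (π v)) (u , v , refl , refl , uv))

-- `ι ∘ π` redirects `v` to `u` and fixes the rest. The bound `m ≤ k` keeps quotients among the
-- graphs that have representatives; termination will come from the number of pairs instead.
record Merge {k : ℕ} (u v : Fin k) : Set where
  field
    m   : ℕ
    m≤k : m ≤ k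
    π   : Fin k → Fin m
    ι   : Fin m → Fin k
    πι  : ∀ x → π (ι x) ≡ x
    ιπ  : ∀ w → w ≢ v → ι (π w) ≡ w
    ιπv : ι (π v) ≡ u

merge : ∀ {k} {u v : Fin k} → u ≢ v → Merge u v
merge {suc k} {u} {v} u≢v = record
  { m = k ; m≤k = n≤1+n k ; π = π ; ι = punchIn v ; πι = πι ; ιπ = ιπ ; ιπv = ιπv }
  where
  π : Fin (suc k) → Fin k
  π w with v ≟ w
  ... | yes _  = punchOut (u≢v ∘ ≡-sym)
  ... | no v≢w = punchOut v≢w
  πι : ∀ x → π (punchIn v x) ≡ x
  πι x with v ≟ punchIn v x
  ... | yes eq = contradiction (≡-sym eq) (punchInᵢ≢i v x)
  ... | no v≢  = trans (punchOut-cong v refl) (punchOut-punchIn v)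
  ιπ : ∀ w → w ≢ v → punchIn v (π w) ≡ w
  ιπ w w≢v with v ≟ w
  ... | yes eq = contradiction (≡-sym eq) w≢v
  ... | no v≢w = punchIn-punchOut v≢w
  ιπv : punchIn v (π v) ≡ u
  ιπv with v ≟ v
  ... | yes _  = punchIn-punchOut (u≢v ∘ ≡-sym)
  ... | no v≢v = contradiction refl v≢v

-- Homomorphisms separating prescribed pairs

Separates : ∀ {a b} → (Fin a → Fin b) → Fin a × Fin a → Set
Separates f (u , v) = f u ≢ f v

identifies? : ∀ {a b} (u v : Fin a) → Decidable (λ (f : Vec (Fin b) a) → lookup f u ≡ lookup f v)
identifies? u v f = lookup f u ≟ lookup f v

-- Interpolates between all homomorphisms, for empty `D`, and embeddings, when `D` contains every
-- pair of distinct vertices.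
sepHoms : (F H : Graph) → List (Fin (n F) × Fin (n F)) → List (Vec (Fin (n H)) (n F))
sepHoms F H []            = homs F H
sepHoms F H ((u , v) ∷ D) = filter (¬? ∘ identifies? u v) (sepHoms F H D)

sepHoms-unique : ∀ F H D → Unique (sepHoms F H D)
sepHoms-unique F H []            = homs-unique F H
sepHoms-unique F H ((u , v) ∷ D) = Unique.filter⁺ (¬? ∘ identifies? u v) (sepHoms-unique F H D)

∈-sepHoms⁺ : ∀ F H {D f} → IsHom F H (lookup f) → All (Separates (lookup f)) D → f ∈ sepHoms F H D
∈-sepHoms⁺ F H f-hom []           = ∈-homs⁺ F H f-hom
∈-sepHoms⁺ F H f-hom (sep ∷ seps) = ∈-filter⁺ (¬? ∘ identifies? _ _) (∈-sepHoms⁺ F H f-hom seps) sep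

∈-sepHoms⁻ : ∀ F H D {f} → f ∈ sepHoms F H D → IsHom F H (lookup f) × All (Separates (lookup f)) D
∈-sepHoms⁻ F H []            f∈ = ∈-homs⁻ F H f∈ , []
∈-sepHoms⁻ F H ((u , v) ∷ D) f∈ with ∈-filter⁻ (¬? ∘ identifies? u v) {xs = sepHoms F H D} f∈
... | f∈D , sep with ∈-sepHoms⁻ F H D f∈D
... | f-hom , seps = f-hom , sep ∷ seps

module _ (F H : Graph) {u v : Fin (n F)} (M : Merge u v) (D : List (Fin (n F) × Fin (n F))) where

  open Merge M

  private
    F/ = image F π
    D/ = map (Product.map π π) D

    descend : Vec (Fin (n H)) (n F) → Vec (Fin (n H)) m
    descend f = tabulate (lookup f ∘ ι)

    lift : Vec (Fin (n H)) m → Vec (Fin (n H)) (n F)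
    lift g = tabulate (lookup g ∘ π)

    identified : List (Vec (Fin (n H)) (n F))
    identified = filter (identifies? u v) (sepHoms F H D)

    lookup-descend : ∀ {f} → lookup f u ≡ lookup f v → ∀ w → lookup (descend f) (π w) ≡ lookup f w
    lookup-descend {f} fu≡fv w = trans (Vec.lookup∘tabulate (lookup f ∘ ι) (π w)) (factor w)
      where
      factor : ∀ w → lookup f (ι (π w)) ≡ lookup f w
      factor w with w ≟ v
      ... | yes refl = trans (cong (lookup f) ιπv) fu≡fv
      ... | no w≢v   = cong (lookup f) (ιπ w w≢v)

    lookup-lift : ∀ g w → lookup (lift g) w ≡ lookup g (π w)
    lookup-lift g = Vec.lookup∘tabulate (lookup g ∘ π)

    πu≡πv : π u ≡ π v
    πu≡πv = trans (cong π (≡-sym ιπv)) (πι (π v))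

    descend∈ : ∀ {f} → f ∈ identified → descend f ∈ sepHoms F/ H D/
    descend∈ {f} f∈ =
      let f∈D , fu≡fv = ∈-filter⁻ (identifies? u v) {xs = sepHoms F H D} f∈
          f-hom , seps = ∈-sepHoms⁻ F H D f∈D
          eq = lookup-descend {f} fu≡fv
      in ∈-sepHoms⁺ F/ H {D/}
           (image-hom⁺ F H π {lookup (descend f)} (isHom-cong F H (λ w → ≡-sym (eq w)) f-hom))
           (All.map⁺ (All.map (λ {(a , b)} fa≢fb same →
             fa≢fb (trans (≡-sym (eq a)) (trans same (eq b)))) seps))

    lift∈ : ∀ {g} → g ∈ sepHoms F/ H D/ → lift g ∈ identified
    lift∈ {g} g∈ =
      let g-hom , seps = ∈-sepHoms⁻ F/ H D/ g∈
          eq = lookup-lift g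
      in ∈-filter⁺ (identifies? u v)
           (∈-sepHoms⁺ F H {D}
             (isHom-cong F H (λ w → ≡-sym (eq w)) (image-hom⁻ F H π {lookup g} g-hom))
             (All.map (λ {(a , b)} ga≢gb same →
               ga≢gb (trans (≡-sym (eq a)) (trans same (eq b)))) (All.map⁻ seps)))
           (trans (eq u) (trans (cong (lookup g) πu≡πv) (≡-sym (eq v))))

  -- A homomorphism with equal values at `u` and `v` factors uniquely through the quotient, and its
  -- separation constraints are carried along `π`.
  sepHoms-contract : length identified ≡ length (sepHoms F/ H D/)
  sepHoms-contract = bijection⇒length≡ descend lift
    (Unique.filter⁺ (identifies? u v) (sepHoms-unique F H D)) (sepHoms-unique F/ H D/)
    descend∈ lift∈
    (λ {f} f∈ → lookup-injective λ w → trans (lookup-lift (descend f) w)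
      (lookup-descend {f} (proj₂ (∈-filter⁻ (identifies? u v) {xs = sepHoms F H D} f∈)) w))
    (λ {g} _ → lookup-injective λ x → trans (Vec.lookup∘tabulate (lookup (lift g) ∘ ι) x)
      (trans (lookup-lift g (ι x)) (cong (lookup g) (πι x))))

  deletion-contraction : length (sepHoms F H ((u , v) ∷ D)) + length (sepHoms F/ H D/)
                         ≡ length (sepHoms F H D)
  deletion-contraction = trans (cong (length (sepHoms F H ((u , v) ∷ D)) +_) (≡-sym sepHoms-contract))
    (length-filter-¬ (identifies? u v) (sepHoms F H D))

-- Counting embeddings

distinct? : ∀ {k} → Decidable (λ (e : Fin k × Fin k) → proj₁ e ≢ proj₂ e)
distinct? (u , v) = ¬? (u ≟ v)

distinctPairs : ∀ k → List (Fin k × Fin k)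
distinctPairs k = filter distinct? (pairs k)

embeddings : (F H : Graph) → List (Vec (Fin (n H)) (n F))
embeddings F H = sepHoms F H (distinctPairs (n F))

embeddings-unique : ∀ F H → Unique (embeddings F H)
embeddings-unique F H = sepHoms-unique F H (distinctPairs (n F))

∈-embeddings⁺ : ∀ F H {f} → IsHom F H (lookup f) → Inj (lookup f) → f ∈ embeddings F H
∈-embeddings⁺ F H f-hom f-inj = ∈-sepHoms⁺ F H f-hom
  (All.tabulate λ e∈ fu≡fv → proj₂ (∈-filter⁻ distinct? {xs = pairs (n F)} e∈) (f-inj fu≡fv))

∈-embeddings⁻ : ∀ F H {f} → f ∈ embeddings F H → IsHom F H (lookup f) × Inj (lookup f)
∈-embeddings⁻ F H {f} f∈ with ∈-sepHoms⁻ F H (distinctPairs (n F)) f∈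
... | f-hom , seps = f-hom , λ {u} {v} fu≡fv → decidable-stable (u ≟ v) λ u≢v →
  All.lookup seps (∈-filter⁺ distinct? (∈-pairs (u , v)) u≢v) fu≡fv

no-embedding⇒length≡0 : ∀ F H → ¬ (F ↪ H) → length (embeddings F H) ≡ 0
no-embedding⇒length≡0 F H none with embeddings F H in eq
... | []    = refl
... | f ∷ _ = contradiction (lookup f , ∈-embeddings⁻ F H (subst (f ∈_) (≡-sym eq) (here refl))) none

module _ {k : ℕ} where

  _∘ᵥ_ : Vec (Fin k) k → Vec (Fin k) k → Vec (Fin k) k
  f ∘ᵥ g = tabulate (lookup f ∘ lookup g)

  idᵥ : Vec (Fin k) k
  idᵥ = tabulate id

  lookup-∘ᵥ : ∀ f g i → lookup (f ∘ᵥ g) i ≡ lookup f (lookup g i)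
  lookup-∘ᵥ f g = Vec.lookup∘tabulate (lookup f ∘ lookup g)

  lookup-idᵥ : ∀ i → lookup idᵥ i ≡ i
  lookup-idᵥ = Vec.lookup∘tabulate id

  ∘ᵥ-isMonoid : IsMonoid _≡_ _∘ᵥ_ idᵥ
  ∘ᵥ-isMonoid = record
    { isSemigroup = record
      { isMagma = record { isEquivalence = isEquivalence ; ∙-cong = cong₂ _∘ᵥ_ }
      ; assoc   = λ f g h → lookup-injective λ i → begin
          lookup ((f ∘ᵥ g) ∘ᵥ h) i           ≡⟨ lookup-∘ᵥ (f ∘ᵥ g) h i ⟩
          lookup (f ∘ᵥ g) (lookup h i)       ≡⟨ lookup-∘ᵥ f g (lookup h i) ⟩
          lookup f (lookup g (lookup h i))   ≡⟨ cong (lookup f) (lookup-∘ᵥ g h i) ⟨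
          lookup f (lookup (g ∘ᵥ h) i)       ≡⟨ lookup-∘ᵥ f (g ∘ᵥ h) i ⟨
          lookup (f ∘ᵥ (g ∘ᵥ h)) i           ∎ }
    ; identity = (λ f → lookup-injective λ i → trans (lookup-∘ᵥ idᵥ f i) (lookup-idᵥ (lookup f i)))
               , (λ f → lookup-injective λ i → trans (lookup-∘ᵥ f idᵥ i) (cong (lookup f) (lookup-idᵥ i))) }
    where open ≡-Reasoning

  lookup-power : ∀ m f i → lookup (Vec.foldr′ _∘ᵥ_ idᵥ (replicate m f)) i ≡ iter (lookup f) m i
  lookup-power zero    f i = lookup-idᵥ i
  lookup-power (suc m) f i = trans (lookup-∘ᵥ f (Vec.foldr′ _∘ᵥ_ idᵥ (replicate m f)) i) (cong (lookup f) (lookup-power m f i))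

  -- The default `y` makes `inverse` total on all self-maps; it is returned only off the image of
  -- `f`.
  preimage : (Fin k → Fin k) → Fin k → Fin k
  preimage f y with any? (λ x → f x ≟ y)
  ... | yes (x , _) = x
  ... | no _        = y

  preimage-correct : ∀ (f : Fin k → Fin k) {y : Fin k} → (∃ λ x → y ≡ f x) → f (preimage f y) ≡ y
  preimage-correct f {y} (x , y≡fx) with any? (λ x → f x ≟ y)
  ... | yes (_ , eq) = eq
  ... | no ¬∃        = contradiction (x , ≡-sym y≡fx) ¬∃

  inverse : Vec (Fin k) k → Vec (Fin k) k
  inverse f = tabulate (preimage (lookup f))

module _ (H : Graph) where

  private
    -- Self-embeddings are automorphisms, by the equality case of the rank comparison with `≤-refl`.
    Aut : List (Vec (Fin (n H)) (n H))
    Aut = embeddings H H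

    surjective : ∀ {f} → f ∈ Aut → ∀ y → ∃ λ x → y ≡ lookup f x
    surjective f∈ = let f-hom , f-inj = ∈-embeddings⁻ H H f∈ in
      embedding⇒surjective {H} {H} f-hom f-inj ≤-refl

    lookup-inverse : ∀ {f} → f ∈ Aut → ∀ y → lookup f (lookup (inverse f) y) ≡ y
    lookup-inverse {f} f∈ y = trans
      (cong (lookup f) (Vec.lookup∘tabulate (preimage (lookup f)) y))
      (preimage-correct (lookup f) (surjective f∈ y))

    idᵥ∈ : idᵥ ∈ Aut
    idᵥ∈ = ∈-embeddings⁺ H H (isHom-cong H H (λ i → ≡-sym (lookup-idᵥ i)) λ _ _ uv → uv)
      λ eq → trans (≡-sym (lookup-idᵥ _)) (trans eq (lookup-idᵥ _))

    ∘ᵥ∈ : ∀ {f g} → f ∈ Aut → g ∈ Aut → f ∘ᵥ g ∈ Aut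
    ∘ᵥ∈ {f} {g} f∈ g∈ =
      let f-hom , f-inj = ∈-embeddings⁻ H H f∈
          g-hom , g-inj = ∈-embeddings⁻ H H g∈
      in ∈-embeddings⁺ H H
           (isHom-cong H H (λ i → ≡-sym (lookup-∘ᵥ f g i)) (isHom-∘ {H} {H} H g-hom f-hom))
           (λ eq → g-inj (f-inj (trans (≡-sym (lookup-∘ᵥ f g _)) (trans eq (lookup-∘ᵥ f g _)))))

    inverse∈ : ∀ {f} → f ∈ Aut → inverse f ∈ Aut
    inverse∈ {f} f∈ = let f-hom , f-inj = ∈-embeddings⁻ H H f∈ in ∈-embeddings⁺ H H
      (λ u v uv → reflects-edges {H} {H} f-hom f-inj ≤-refl _ _
        (subst id (cong₂ (Edge H) (≡-sym (lookup-inverse f∈ u)) (≡-sym (lookup-inverse f∈ v))) uv))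
      (λ eq → trans (≡-sym (lookup-inverse f∈ _)) (trans (cong (lookup f) eq) (lookup-inverse f∈ _)))

    inverseˡ : ∀ {f} → f ∈ Aut → inverse f ∘ᵥ f ≡ idᵥ
    inverseˡ {f} f∈ = lookup-injective λ i →
      let f-hom , f-inj = ∈-embeddings⁻ H H f∈ in begin
        lookup (inverse f ∘ᵥ f) i          ≡⟨ lookup-∘ᵥ (inverse f) f i ⟩
        lookup (inverse f) (lookup f i)    ≡⟨ f-inj (lookup-inverse f∈ (lookup f i)) ⟩
        i                                  ≡⟨ lookup-idᵥ i ⟨
        lookup idᵥ i                       ∎
      where open ≡-Reasoning

    _≟ᵥ_ : DecidableEquality (Vec (Fin (n H)) (n H))
    _≟ᵥ_ = Vec.≡-dec _≟_

    -- A vertex moved by `f` would make `f` an automorphism of order `p`.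
    order-p⇒trivial : ∀ {p} → OrderReduced p H → ∀ {f} → f ∈ Aut →
                      Vec.foldr′ _∘ᵥ_ idᵥ (replicate p f) ≡ idᵥ → f ≡ idᵥ
    order-p⇒trivial {p} reduced {f} f∈ f^p≡id = lookup-injective λ i →
      trans (decidable-stable (lookup f i ≟ i) (λ moved → reduced
        (embedding⇒iso {H} {H} (proj₁ (∈-embeddings⁻ H H f∈)) (proj₂ (∈-embeddings⁻ H H f∈)) ≤-refl
        , (i , moved)
        , λ v → trans (≡-sym (lookup-power p f v)) (trans (cong (λ g → lookup g v) f^p≡id) (lookup-idᵥ v)))))
      (≡-sym (lookup-idᵥ i))

  orderReduced⇒∤∣Aut∣ : ∀ {p} → Prime p → OrderReduced p H → ¬ p ∣ length (embeddings H H)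
  orderReduced⇒∤∣Aut∣ {zero}        p-prime = contradiction p-prime ¬prime[0]
  orderReduced⇒∤∣Aut∣ {suc zero}    p-prime = contradiction p-prime ¬prime[1]
  orderReduced⇒∤∣Aut∣ {suc (suc q)} p-prime reduced =
    cauchy _≟ᵥ_ ∘ᵥ-isMonoid inverse (embeddings-unique H H) idᵥ∈ ∘ᵥ∈ inverse∈ inverseˡ
      p-prime (order-p⇒trivial {suc (suc q)} reduced)

-- Representatives of the isomorphism classes of small graphs

-- The disjunction symmetrises, so every Boolean matrix yields a graph and plain words can be
-- counted. A matrix that is already symmetric is unchanged.
matrixGraph : ∀ {m} → Vec (Vec Bool m) m → Graph
matrixGraph {m} M = record
  { n   = m
  ; adj = λ u v → lookup (lookup M u) v ∨ lookup (lookup M v) u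
  ; sym = λ u v → Bool.∨-comm (lookup (lookup M u) v) (lookup (lookup M v) u) }

adjacencyMatrix : ∀ G → Vec (Vec Bool (n G)) (n G)
adjacencyMatrix G = tabulate λ u → tabulate (adj G u)

iso-matrixGraph : ∀ G → Iso G (matrixGraph (adjacencyMatrix G))
iso-matrixGraph G = record
  { to = id ; from = id ; from-to = λ _ → refl ; to-from = λ _ → refl
  ; pres = λ u v → ≡-sym (trans (cong₂ _∨_ (entry u v) (trans (entry v u) (sym G v u))) (Bool.∨-idem (adj G u v))) }
  where
  entry : ∀ u v → lookup (lookup (adjacencyMatrix G) u) v ≡ adj G u v
  entry u v = trans (cong (λ row → lookup row v) (Vec.lookup∘tabulate (λ u → tabulate (adj G u)) u))
    (Vec.lookup∘tabulate (adj G u) v)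

bools : List Bool
bools = false ∷ true ∷ []

∈-bools : ∀ b → b ∈ bools
∈-bools false = here refl
∈-bools true  = there (here refl)

graphsOfOrder : ℕ → List Graph
graphsOfOrder m = map matrixGraph (words (words bools m) m)

length-graphsOfOrder : ∀ m → length (graphsOfOrder m) ≡ 2 ^ (m * m)
length-graphsOfOrder m = begin
  length (graphsOfOrder m)         ≡⟨ length-map matrixGraph (words (words bools m) m) ⟩
  length (words (words bools m) m) ≡⟨ length-words (words bools m) m ⟩
  length (words bools m) ^ m       ≡⟨ cong (_^ m) (length-words bools m) ⟩
  (2 ^ m) ^ m                      ≡⟨ ^-*-assoc 2 m m ⟩
  2 ^ (m * m)                      ∎
  where open ≡-Reasoning

graphsOfOrder-complete : ∀ G → Any (Iso G) (graphsOfOrder (n G))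
graphsOfOrder-complete G = lose
  (∈-map⁺ matrixGraph (∈-words⁺ (VAll.universal (λ row → ∈-words⁺ (VAll.universal ∈-bools row)) (adjacencyMatrix G))))
  (iso-matrixGraph G)

graphsUpTo : ℕ → List Graph
graphsUpTo zero    = graphsOfOrder zero
graphsUpTo (suc N) = graphsOfOrder (suc N) ++ graphsUpTo N

-- With exponent `(1 + N) * (1 + N)` the bound for orders up to `N` equals the number of matrices of
-- order `suc N`. The sum is then one doubling, which the next square absorbs.
length-graphsUpTo : ∀ N → length (graphsUpTo N) ≤ 2 ^ ((1 + N) * (1 + N))
length-graphsUpTo zero    = s≤s z≤n
length-graphsUpTo (suc N) = begin
  length (graphsOfOrder (suc N) ++ graphsUpTo N)
    ≡⟨ List.length-++ (graphsOfOrder (suc N)) ⟩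
  length (graphsOfOrder (suc N)) + length (graphsUpTo N)
    ≤⟨ +-mono-≤ (≤-reflexive (length-graphsOfOrder (suc N))) (length-graphsUpTo N) ⟩
  2 ^ (suc N * suc N) + 2 ^ (suc N * suc N)
    ≡⟨ cong (2 ^ (suc N * suc N) +_) (+-identityʳ (2 ^ (suc N * suc N))) ⟨
  2 ^ suc (suc N * suc N)
    ≤⟨ ^-monoʳ-≤ 2 (s≤s (≤-trans (*-monoʳ-≤ (suc N) (n≤1+n (suc N))) (m≤n+m (suc N * suc (suc N)) (suc N)))) ⟩
  2 ^ (suc (suc N) * suc (suc N)) ∎
  where open ≤-Reasoning

graphsUpTo-complete : ∀ N G → n G ≤ N → Any (Iso G) (graphsUpTo N)
graphsUpTo-complete zero    G n≤N with n≤0⇒n≡0 n≤N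
... | eq = subst (λ m → Any (Iso G) (graphsOfOrder m)) eq (graphsOfOrder-complete G)
graphsUpTo-complete (suc N) G n≤N with m≤n⇒m<n∨m≡n n≤N
... | inj₁ (s≤s n≤N′) = Any.++⁺ʳ (graphsOfOrder (suc N)) (graphsUpTo-complete N G n≤N′)
... | inj₂ eq = Any.++⁺ˡ (subst (λ m → Any (Iso G) (graphsOfOrder m)) eq (graphsOfOrder-complete G))

isoDecSetoid : DecSetoid _ _
isoDecSetoid = record
  { Carrier = Graph
  ; _≈_     = Iso
  ; isDecEquivalence = record
    { isEquivalence = record { refl = iso-refl ; sym = iso-sym ; trans = iso-trans }
    ; _≟_ = iso? } }

representatives : ℕ → List Graph
representatives N = deduplicate iso? (graphsUpTo N)

representatives-complete : ∀ N G → n G ≤ N → Any (Iso G) (representatives N)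
representatives-complete N G n≤N =
  Any.deduplicate⁺ iso? (λ yx Gy → iso-trans Gy (iso-sym yx)) (graphsUpTo-complete N G n≤N)

length-representatives : ∀ N → length (representatives N) ≤ 2 ^ ((1 + N) * (1 + N))
length-representatives N = ≤-trans (List.length-deduplicate iso? (graphsUpTo N)) (length-graphsUpTo N)

-- Arithmetic modulo p

module Modular (p : ℕ) {{_ : NonZero p}} where

  infix 4 _≈_
  -- Equality of remainders inherits `refl` and `trans` from `_≡_`; the existential form is produced
  -- only at the end.
  _≈_ : ℕ → ℕ → Set
  x ≈ y = x % p ≡ y % p

  ≈-reflexive : ∀ {x y} → x ≡ y → x ≈ y
  ≈-reflexive = cong (_% p)

  +-cong-≈ : ∀ {a b c d} → a ≈ b → c ≈ d → a + c ≈ b + d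
  +-cong-≈ {a} {b} {c} {d} ab cd = trans (%-distribˡ-+ a c p)
    (trans (cong₂ (λ x y → (x + y) % p) ab cd) (≡-sym (%-distribˡ-+ b d p)))

  *-cong-≈ : ∀ {a b c d} → a ≈ b → c ≈ d → a * c ≈ b * d
  *-cong-≈ {a} {b} {c} {d} ab cd = trans (%-distribˡ-* a c p)
    (trans (cong₂ (λ x y → (x * y) % p) ab cd) (≡-sym (%-distribˡ-* b d p)))

  ≈⇒≡[mod] : ∀ {x y} → x ≈ y → x ≡ y [mod p ]
  -- Each side is topped up by the other's quotient, so both equal the common remainder plus both
  -- multiples of `p`.
  ≈⇒≡[mod] {x} {y} x≈y = y / p , x / p , (begin
    x + y / p * p                  ≡⟨ cong (_+ y / p * p) (m≡m%n+[m/n]*n x p) ⟩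
    x % p + x / p * p + y / p * p  ≡⟨ +-assoc (x % p) (x / p * p) (y / p * p) ⟩
    x % p + (x / p * p + y / p * p)  ≡⟨ cong₂ _+_ x≈y (+-comm (x / p * p) (y / p * p)) ⟩
    y % p + (y / p * p + x / p * p)  ≡⟨ +-assoc (y % p) (y / p * p) (x / p * p) ⟨
    y % p + y / p * p + x / p * p    ≡⟨ cong (_+ x / p * p) (m≡m%n+[m/n]*n y p) ⟨
    y + x / p * p                  ∎)
    where open ≡-Reasoning

  a+[p-1]a≡a*p : ∀ a → a + pred p * a ≡ a * p
  a+[p-1]a≡a*p a = trans (cong (_* a) (suc-pred p)) (*-comm p a)

  a+[p-1]a≈0 : ∀ a → a + pred p * a ≈ 0
  a+[p-1]a≈0 a = trans (≈-reflexive (a+[p-1]a≡a*p a)) ([m+kn]%n≡m%n 0 a p)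

  -- Subtraction of `b` modulo `p`: adding `pred p * b` to `a + b` yields `a` plus a multiple of
  -- `p`.
  subtract : ∀ {a b c} → a + b ≡ c → c + pred p * b ≈ a
  subtract {a} {b} {c} eq = trans (≈-reflexive (begin
    c + pred p * b         ≡⟨ cong (_+ pred p * b) eq ⟨
    a + b + pred p * b     ≡⟨ +-assoc a b (pred p * b) ⟩
    a + (b + pred p * b)   ≡⟨ cong (a +_) (a+[p-1]a≡a*p b) ⟩
    a + b * p              ∎)) ([m+kn]%n≡m%n a b p)
    where open ≡-Reasoning

  invertible : Prime p → ∀ a → ¬ p ∣ a → ∃ λ b → b * a ≈ 1
  invertible p-prime a p∤a with coprime-Bézout coprime
    where
    coprime : Coprime p a
    coprime (d∣p , d∣a) with prime⇒irreducible p-prime d∣p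
    ... | inj₁ d≡1  = d≡1
    ... | inj₂ refl = ⊥-elim (p∤a d∣a)
  ... | Bézout.-+ x y eq = y , trans (≈-reflexive (≡-sym eq)) ([m+kn]%n≡m%n 1 x p)
  -- This sign says that `y * a` is -1 modulo `p`, so the inverse is -`y`.
  ... | Bézout.+- x y eq = pred p * y , (begin
    (pred p * y * a) % p            ≡⟨ ≈-reflexive (*-assoc (pred p) y a) ⟩
    (pred p * (y * a)) % p          ≡⟨ +-cong-≈ {x * p} {0} ([m+kn]%n≡m%n 0 x p) refl ⟨
    (x * p + pred p * (y * a)) % p  ≡⟨ subtract {1} eq ⟩
    1 % p                           ∎)
    where open ≡-Reasoning

  sum-cong-≈ : ∀ {m} {f g : Fin m → ℕ} → (∀ i → f i ≈ g i) → sum f ≈ sum g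
  sum-cong-≈ {zero}  eq = refl
  sum-cong-≈ {suc m} {f} {g} eq =
    +-cong-≈ {f Fin.zero} {g Fin.zero} (eq Fin.zero) (sum-cong-≈ {f = f ∘ Fin.suc} (eq ∘ Fin.suc))

  sum-≈0 : ∀ {m} {f : Fin m → ℕ} → (∀ i → f i ≈ 0) → sum f ≈ 0
  sum-≈0 {zero}      eq = refl
  sum-≈0 {suc m} {f} eq = +-cong-≈ {f Fin.zero} {0} (eq Fin.zero) (sum-≈0 {f = f ∘ Fin.suc} (eq ∘ Fin.suc))

  sum-single : ∀ {m} {f : Fin m → ℕ} i → (∀ j → j ≢ i → f j ≈ 0) → sum f ≈ f i
  sum-single {suc m} {f} Fin.zero eq = trans
    (+-cong-≈ {f Fin.zero} refl (sum-≈0 {f = f ∘ Fin.suc} λ j → eq (Fin.suc j) λ ()))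
    (≈-reflexive (+-identityʳ (f Fin.zero)))
  sum-single {suc m} {f} (Fin.suc i) eq = +-cong-≈ {f Fin.zero} {0} (eq Fin.zero λ ())
    (sum-single {f = f ∘ Fin.suc} i λ j j≢i → eq (Fin.suc j) (j≢i ∘ Fin.suc-injective))

  -- Linear combinations and triangular elimination

  module Combinations {Y : Set} {m : ℕ} (basis : Fin m → Y → ℕ) where

    combine : (Fin m → ℕ) → Y → ℕ
    combine c y = sum λ i → c i * basis i y

    -- The coefficients are chosen before the argument `y`, so one combination represents `φ`
    -- everywhere modulo `p`.
    Span : (Y → ℕ) → Set
    Span φ = ∃ λ c → ∀ y → combine c y ≈ φ y

    span-resp : ∀ {φ ψ} → (∀ y → φ y ≈ ψ y) → Span φ → Span ψ
    span-resp eq (c , c≈φ) = c , λ y → trans (c≈φ y) (eq y)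

    span-0 : Span λ _ → 0
    span-0 = (λ _ → 0) , λ y → sum-≈0 {m} {λ _ → 0} λ _ → refl

    span-+ : ∀ {φ ψ} → Span φ → Span ψ → Span λ y → φ y + ψ y
    span-+ (c , c≈φ) (d , d≈ψ) = (λ i → c i + d i) , λ y → trans
      (≈-reflexive (trans (sum-cong-≗ λ i → *-distribʳ-+ (basis i y) (c i) (d i))
        (∑-distrib-+ (λ i → c i * basis i y) (λ i → d i * basis i y))))
      (+-cong-≈ {combine c y} (c≈φ y) (d≈ψ y))

    span-* : ∀ {φ} k → Span φ → Span λ y → k * φ y
    span-* k (c , c≈φ) = (λ i → k * c i) , λ y → trans
      (≈-reflexive (trans (sum-cong-≗ λ i → *-assoc k (c i) (basis i y))
        (≡-sym (*-distribˡ-sum k (λ i → c i * basis i y)))))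
      (*-cong-≈ {k} refl (c≈φ y))

    span-sum : ∀ {r} {φ : Fin r → Y → ℕ} → (∀ j → Span (φ j)) → Span λ y → sum λ j → φ j y
    span-sum {zero}  spans = span-0
    span-sum {suc r} spans = span-+ (spans Fin.zero) (span-sum (spans ∘ Fin.suc))

    span-basis : ∀ i → Span (basis i)
    span-basis i = δ , λ y → trans (sum-single i λ j j≢i → ≈-reflexive (cong (_* basis j y) (δ-off j≢i)))
        (≈-reflexive (trans (cong (_* basis i y) δ-on) (*-identityˡ (basis i y))))
      where
      δ : Fin m → ℕ
      δ j with j ≟ i
      ... | yes _ = 1
      ... | no _  = 0
      δ-off : ∀ {j} → j ≢ i → δ j ≡ 0
      δ-off {j} j≢i with j ≟ i
      ... | yes eq = contradiction eq j≢i
      ... | no _   = refl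
      δ-on : δ i ≡ 1
      δ-on with i ≟ i
      ... | yes _  = refl
      ... | no i≢i = contradiction refl i≢i

    module _ (p-prime : Prime p) {r : ℕ} (y : Fin r → Y) (rank : Fin r → ℕ) (M : ℕ) (rank≤M : ∀ i → rank i ≤ M)
             (row : Fin r → Y → ℕ) (row-span : ∀ i → Span (row i))
             (row-triangular : ∀ i j → j ≢ i → rank j ≤ rank i → row i (y j) ≡ 0)
             (row-diagonal : ∀ i → ¬ p ∣ row i (y i)) where

      Dual : Fin r → Set
      Dual i = ∃ λ φ → Span φ × φ (y i) ≈ 1 × (∀ j → j ≢ i → φ (y j) ≈ 0)

      -- A function that cancels the entry of row `i` at `y j` and vanishes at all other sample
      -- points. Having one for every `j`, possibly zero, allows a sum over all of `Fin r`.
      record Correction (i j : Fin r) : Set where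
        field
          ψ        : Y → ℕ
          ψ-span   : Span ψ
          ψ-local  : ∀ k → k ≢ j → ψ (y k) ≈ 0
          ψ-diag   : j ≡ i → ψ (y j) ≈ 0
          ψ-cancel : j ≢ i → row i (y j) + ψ (y j) ≈ 0

      correction : ∀ i j → (rank i < rank j → Dual j) → Correction i j
      correction i j dual with rank i <? rank j
      ... | no ≮ = record
        { ψ        = λ _ → 0
        ; ψ-span   = span-0
        ; ψ-local  = λ _ _ → refl
        ; ψ-diag   = λ _ → refl
        ; ψ-cancel = λ j≢i → ≈-reflexive (trans (+-identityʳ _) (row-triangular i j j≢i (≮⇒≥ ≮))) }
      ... | yes i<j with dual i<j
      ... | φ , φ-span , φ≈1 , φ≈0 = record
        -- This is -`a` times the dual function of `j`, where `a` is the entry to be cancelled.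
        { ψ        = λ z → pred p * a * φ z
        ; ψ-span   = span-* (pred p * a) φ-span
        ; ψ-local  = λ k k≢j → trans (*-cong-≈ {pred p * a} refl (φ≈0 k k≢j)) (≈-reflexive (*-zeroʳ (pred p * a)))
        ; ψ-diag   = λ { refl → contradiction i<j (<-irrefl refl) }
        ; ψ-cancel = λ _ → trans
            (+-cong-≈ {a} refl (trans (*-cong-≈ {pred p * a} refl φ≈1) (≈-reflexive (*-identityʳ (pred p * a)))))
            (a+[p-1]a≈0 a) }
        where
        a = row i (y j)

      -- Downward induction on the rank: the fuel bounds M − rank i.
      dual : ∀ fuel i → M < rank i + fuel → Dual i
      dual zero       i M<rank = contradiction (rank≤M i) (<⇒≱ (subst (M <_) (+-identityʳ (rank i)) M<rank))
      dual (suc fuel) i M<     = (λ z → b * χ z) , span-* b χ-span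
        , trans (*-cong-≈ {b} refl χ-diag) ba≈1
        , λ k k≢i → trans (*-cong-≈ {b} refl (χ-off k k≢i)) (≈-reflexive (*-zeroʳ b))
        where
        -- A recursive call occurs only for `rank i < rank j`, and this strict increase pays for the
        -- unit of fuel.
        module C (j : Fin r) = Correction (correction i j λ i<j →
          dual fuel j (<-≤-trans (subst (M <_) (+-suc (rank i) fuel) M<) (+-monoˡ-≤ fuel i<j)))
        χ : Y → ℕ
        -- At `y k` only the `k`-th correction survives. So `χ` is 0 off `y i` and keeps the
        -- diagonal entry at `y i`, which the factor `b` then normalises to 1.
        χ z = row i z + sum λ j → C.ψ j z
        χ-span : Span χ
        χ-span = span-+ (row-span i) (span-sum C.ψ-span)
        χ≈ : ∀ k → χ (y k) ≈ row i (y k) + C.ψ k (y k)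
        χ≈ k = +-cong-≈ {row i (y k)} refl
          (sum-single {f = λ j → C.ψ j (y k)} k λ j j≢k → C.ψ-local j k (j≢k ∘ ≡-sym))
        χ-off : ∀ k → k ≢ i → χ (y k) ≈ 0
        χ-off k k≢i = trans (χ≈ k) (C.ψ-cancel k k≢i)
        χ-diag : χ (y i) ≈ row i (y i)
        χ-diag = trans (χ≈ i) (trans (+-cong-≈ {row i (y i)} refl (C.ψ-diag i refl))
          (≈-reflexive (+-identityʳ (row i (y i)))))
        b : ℕ
        b = proj₁ (invertible p-prime (row i (y i)) (row-diagonal i))
        ba≈1 : b * row i (y i) ≈ 1
        ba≈1 = proj₂ (invertible p-prime (row i (y i)) (row-diagonal i))

      triangular-dual : ∀ i → Dual i
      triangular-dual i = dual (suc M) i (m≤n+m (suc M) (rank i))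

  -- Quantum graphs

  quantumTerm : ∀ {m} → (Fin m → ℕ) → (Fin m → Graph) → Fin m → Fin p × Graph
  quantumTerm c Gs i = fromℕ< (m%n<n (c i) p) , Gs i

  qhom-tabulate : ∀ {m} (c : Fin m → ℕ) (Gs : Fin m → Graph) H →
                  List.foldr (λ t acc → toℕ (proj₁ t) * hom (proj₂ t) H + acc) 0 (List.tabulate (quantumTerm c Gs))
                  ≈ sum λ i → c i * hom (Gs i) H
  qhom-tabulate {zero}  c Gs H = refl
  qhom-tabulate {suc m} c Gs H = +-cong-≈ {toℕ (proj₁ t) * hom (Gs Fin.zero) H}
    (*-cong-≈ {toℕ (proj₁ t)} {c Fin.zero}
      (trans (≈-reflexive (toℕ-fromℕ< (m%n<n (c Fin.zero) p))) (m%n%n≡m%n (c Fin.zero) p)) refl)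
    (qhom-tabulate (c ∘ Fin.suc) (Gs ∘ Fin.suc) H)
    where
    t = quantumTerm c Gs Fin.zero

  module _ (Gs : List Graph) (Gs-distinct : AllPairs (λ G H → ¬ Iso G H) Gs) where

    open Combinations {Graph} (λ i → hom (List.lookup Gs i)) public

    -- Every graph of `Gs` stays a constituent, even with coefficient 0, so the size is the same for
    -- all `c`.
    quantumGraph : (Fin (length Gs) → ℕ) → QuantumGraph p
    quantumGraph c = record
      { terms    = List.tabulate (quantumTerm c (List.lookup Gs))
      ; distinct = AllPairs.map⁻ (subst (AllPairs (λ G H → ¬ Iso G H)) (≡-sym underlying) Gs-distinct) }
      where
      underlying : map proj₂ (List.tabulate (quantumTerm c (List.lookup Gs))) ≡ Gs
      underlying = trans (List.map-tabulate (quantumTerm c (List.lookup Gs)) proj₂) (List.tabulate-lookup Gs)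

    size-quantumGraph : ∀ c → size (quantumGraph c) ≡ length Gs
    size-quantumGraph c = List.length-tabulate (quantumTerm c (List.lookup Gs))

    qhom-quantumGraph : ∀ {φ} ((c , _) : Span φ) H → qhom (quantumGraph c) H ≈ φ H
    qhom-quantumGraph (c , c≈φ) H = trans (qhom-tabulate c (List.lookup Gs) H) (c≈φ H)

    module _ (N : ℕ) (Gs-complete : ∀ F → n F ≤ N → Any (Iso F) Gs) where

      hom-span : ∀ F → n F ≤ N → Span (hom F)
      hom-span F n≤N = span-resp {hom (List.lookup Gs i)} {hom F}
          (λ H → ≈-reflexive (≡-sym (hom-resp-iso {F} {List.lookup Gs i} H (Any.lookup-index found))))
          (span-basis i)
        where
        found : Any (Iso F) Gs
        found = Gs-complete F n≤N
        i : Fin (length Gs)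
        i = Any.index found

      -- The length `k` drives the recursion because contraction replaces both `F` and the tail of
      -- `D` by images, which are not subterms.
      sepHoms-span : ∀ k F D → length D ≡ k → n F ≤ N → Span λ H → length (sepHoms F H D)
      sepHoms-span _ F [] _ n≤N =
        span-resp {hom F} (λ H → ≈-reflexive (≡-sym (length-homs F H))) (hom-span F n≤N)
      sepHoms-span (suc k) F ((u , v) ∷ D) eq n≤N with u ≟ v
      -- An earlier contraction may have turned a pair into a diagonal one, for instance `(v , u)`
      -- after merging `u` and `v`. Nothing separates it, so the count is 0.
      ... | yes refl = span-resp {λ _ → 0} (λ H → ≈-reflexive (cong length (≡-sym
              (List.filter-none (¬? ∘ identifies? u u) (All.universal (λ _ u≢u → u≢u refl) (sepHoms F H D))))))
            span-0
      ... | no u≢v = span-resp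
            {λ H → length (sepHoms F H D) + pred p * length (sepHoms (image F π) H (map (Product.map π π) D))}
            (λ H → subtract (deletion-contraction F H (merge u≢v) D))
            (span-+ (sepHoms-span k F D (suc-injective eq) n≤N)
              (span-* (pred p) (sepHoms-span k (image F π) (map (Product.map π π) D)
                (trans (length-map (Product.map π π) D) (suc-injective eq)) (≤-trans m≤k n≤N))))
            where open Merge (merge u≢v)

      embeddings-span : ∀ F → n F ≤ N → Span λ H → length (embeddings F H)
      embeddings-span F n≤N = sepHoms-span _ F (distinctPairs (n F)) refl n≤N

-- The embedding matrix of the given family and its dual quantum graphs

n≤totalVertices : ∀ {r} (H : Fin r → Graph) i → n (H i) ≤ totalVertices r H
n≤totalVertices {suc r} H Fin.zero    = m≤m+n (n (H Fin.zero)) (totalVertices r (H ∘ Fin.suc))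
n≤totalVertices {suc r} H (Fin.suc i) =
  ≤-trans (n≤totalVertices (H ∘ Fin.suc) i) (m≤n+m (totalVertices r (H ∘ Fin.suc)) (n (H Fin.zero)))

module _ {p : ℕ} (p-prime : Prime p) {r : ℕ} (H : Fin r → Graph)
         (H-distinct : ∀ i j → i ≢ j → ¬ Iso (H i) (H j))
         (H-reduced : ∀ i → OrderReduced p (H i)) where

  private
    instance
      p-nonZero : NonZero p
      p-nonZero = prime⇒nonZero p-prime

    N : ℕ
    N = totalVertices r H

    Gs-distinct : AllPairs (λ G H → ¬ Iso G H) (representatives N)
    Gs-distinct = deduplicate-! isoDecSetoid (graphsUpTo N)

    open Modular p

    bounded : ∀ i → rank (H i) ≤ N + N * N
    bounded i = ≤-trans (rank≤ (H i))
      (+-mono-≤ (n≤totalVertices H i) (*-mono-≤ (n≤totalVertices H i) (n≤totalVertices H i)))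

    row : Fin r → Graph → ℕ
    row i G = length (embeddings (H i) G)

    row-span : ∀ i → Span (representatives N) Gs-distinct (row i)
    row-span i = embeddings-span (representatives N) Gs-distinct N (representatives-complete N)
      (H i) (n≤totalVertices H i)

    row-triangular : ∀ i j → j ≢ i → rank (H j) ≤ rank (H i) → row i (H j) ≡ 0
    row-triangular i j j≢i rank≤ = no-embedding⇒length≡0 (H i) (H j) λ (f , f-hom , f-inj) →
      H-distinct i j (j≢i ∘ ≡-sym) (embedding⇒iso {H i} {H j} f-hom f-inj rank≤)

    row-diagonal : ∀ i → ¬ p ∣ row i (H i)
    row-diagonal i = orderReduced⇒∤∣Aut∣ (H i) p-prime (H-reduced i)

    duals : ∀ i → Dual (representatives N) Gs-distinct p-prime H (rank ∘ H) (N + N * N) bounded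
                    row row-span row-triangular row-diagonal i
    duals = triangular-dual (representatives N) Gs-distinct p-prime H (rank ∘ H) (N + N * N) bounded
              row row-span row-triangular row-diagonal

  dualQuantumGraph : Fin r → QuantumGraph p
  dualQuantumGraph i = quantumGraph (representatives N) Gs-distinct (proj₁ (proj₁ (proj₂ (duals i))))

  size-dualQuantumGraph : ∀ i → size (dualQuantumGraph i) ≤ 2 ^ ((1 + N) * (1 + N))
  size-dualQuantumGraph i = ≤-trans
    (≤-reflexive (size-quantumGraph (representatives N) Gs-distinct (proj₁ (proj₁ (proj₂ (duals i))))))
    (length-representatives N)

  qhom-dual-diagonal : ∀ i → qhom (dualQuantumGraph i) (H i) ≡ 1 [mod p ]
  qhom-dual-diagonal i = let φ , φ-span , φ≈1 , _ = duals i in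
    ≈⇒≡[mod] (trans (qhom-quantumGraph (representatives N) Gs-distinct {φ} φ-span (H i)) φ≈1)

  qhom-dual-off-diagonal : ∀ i j → i ≢ j → qhom (dualQuantumGraph i) (H j) ≡ 0 [mod p ]
  qhom-dual-off-diagonal i j i≢j = let φ , φ-span , _ , φ≈0 = duals i in
    ≈⇒≡[mod] (trans (qhom-quantumGraph (representatives N) Gs-distinct {φ} φ-span (H j)) (φ≈0 j (i≢j ∘ ≡-sym)))

theorem3p6 : (p : ℕ) → Prime p →
    ∃ λ (k : ℕ) → ∃ λ (d : ℕ) →
    (r : ℕ) (H : Fin r → Graph) →
    (∀ i j → i ≢ j → ¬ Iso (H i) (H j)) →
    (∀ i → OrderReduced p (H i)) →
    ∃ λ (F : Fin r → QuantumGraph p) →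
    (∀ i → size (F i) ≤ 2 ^ (k * (1 + totalVertices r H) ^ d)) ×
    (∀ i → qhom (F i) (H i) ≡ 1 [mod p ]) ×
    (∀ i j → i ≢ j → qhom (F i) (H j) ≡ 0 [mod p ])
-- The constants 1 and 2 express the exponent `(1 + N) * (1 + N)` of the bound on representatives,
-- `N` being the total number of vertices.
theorem3p6 p p-prime = 1 , 2 , λ r H H-distinct H-reduced →
  dualQuantumGraph p-prime H H-distinct H-reduced
  , (λ i → subst (λ e → size (dualQuantumGraph p-prime H H-distinct H-reduced i) ≤ 2 ^ e)
       (square (1 + totalVertices r H)) (size-dualQuantumGraph p-prime H H-distinct H-reduced i))
  , qhom-dual-diagonal p-prime H H-distinct H-reduced
  , qhom-dual-off-diagonal p-prime H H-distinct H-reduced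
  where
  square : ∀ m → m * m ≡ 1 * m ^ 2
  square m = trans (cong (m *_) (≡-sym (*-identityʳ m))) (≡-sym (*-identityˡ (m ^ 2)))
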